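{- For every integer $r\geq 2$ and every real $\varepsilon>0$ there exist a real $\eta>0$ and an integer $n_0$ such that every $3$-uniform hypergraph $H$ with at least $n_0$ vertices which is $\bigl(\frac{r-2}{r-1}+\varepsilon,\eta\bigr)$-ee-dense contains a copy of the complete $3$-uniform hypergraph $K_{2^r}^{(3)}$ on $2^r$ vertices. In other words, $\pi_{\mathrm{ee}}(K_{2^r}^{(3)})\leq\frac{r-2}{r-1}$.
   Context: Let $H=(V,E)$ be a $3$-uniform hypergraph on $n=|V|$ vertices. For two sets of ordered pairs $P,Q\subseteq V\times V$ let $\mathcal K(P,Q)$ denote the set of pairs $((x,y),(x',z))\in P\times Q$ with $x=x'$ (i.e. of the form $((x,y),(x,z))$), and let $e(P,Q)$ be the number of such pairs $((x,y),(x,z))\in P\times Q$ with $\{x,y,z\}\in E$. For $d\in[0,1]$ and $\eta>0$, $H$ is called $(d,\eta)$-ee-dense if for all $P,Q\subseteq V\times V$ we have $e(P,Q)\geq d\,|\mathcal K(P,Q)|-\eta n^3$. For a $3$-uniform hypergraph $F$, $\pi_{\mathrm{ee}}(F)$ is the supremum of all $d\in[0,1]$ such that for every $\eta>0$ and every $n\in\mathbb N$ there exists an $F$-free $3$-uniform $(d,\eta)$-ee-dense hypergraph with at least $n$ vertices. -}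

module Defs where

open import Data.Bool using (Bool; true; false; if_then_else_)
open import Data.Nat using (ℕ; zero; suc; _^_)
import Data.Nat as ℕ
open import Data.Fin using (Fin)
open import Data.List using (List; map)
open import Data.Nat.ListAction using (sum)
open import Data.List using () renaming (allFin to allFinL)
open import Data.Rational using (ℚ; _≤_; _*_; _-_; _+_; _/_)
import Data.Rational as ℚ
open import Data.Integer using (+_)
open import Data.Product using (_×_; Σ)
open import Relation.Binary.PropositionalEquality using (_≡_; _≢_)
open import Function.Definitions using (Injective)

record Hypergraph3 (n : ℕ) : Set where
  field
    edge      : Fin n → Fin n → Fin n → Bool
    sym₁₂     : ∀ x y z → edge x y z ≡ edge y x z
    sym₂₃     : ∀ x y z → edge x y z ≡ edge x z y
    distinct  : ∀ x y z → edge x y z ≡ true → (x ≢ y) × (y ≢ z) × (x ≢ z)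
open Hypergraph3 public

ΣFin : (n : ℕ) → (Fin n → ℕ) → ℕ
ΣFin n f = sum (map f (allFinL n))

𝟙 : Bool → ℕ
𝟙 b = if b then 1 else 0

PairSet : ℕ → Set
PairSet n = Fin n → Fin n → Bool

Kcount : {n : ℕ} → PairSet n → PairSet n → ℕ
Kcount {n} P Q = ΣFin n λ x → ΣFin n λ y → ΣFin n λ z →
  𝟙 (P x y) ℕ.* 𝟙 (Q x z)

ecount : {n : ℕ} → Hypergraph3 n → PairSet n → PairSet n → ℕ
ecount {n} H P Q = ΣFin n λ x → ΣFin n λ y → ΣFin n λ z →
  𝟙 (P x y) ℕ.* 𝟙 (Q x z) ℕ.* 𝟙 (edge H x y z)

toℚ : ℕ → ℚ
toℚ k = (+ k) / 1

EEDense : {n : ℕ} → Hypergraph3 n → ℚ → ℚ → Set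
EEDense {n} H d η = ∀ (P Q : PairSet n) →
  d * toℚ (Kcount P Q) - η * toℚ (n ^ 3) ≤ toℚ (ecount H P Q)

ContainsK : {n : ℕ} → Hypergraph3 n → ℕ → Set
ContainsK {n} H m = Σ (Fin m → Fin n) λ f → Injective _≡_ _≡_ f ×
  (∀ i j k → i ≢ j → j ≢ k → i ≢ k → edge H (f i) (f j) (f k) ≡ true)

-- the density threshold (r-2)/(r-1), written for r ≥ 2 as (r∸2)/(1+(r∸2))
threshold : ℕ → ℚ
threshold r = (+ (r ℕ.∸ 2)) / suc (r ℕ.∸ 2)

{-# OPTIONS --safe #-}
module Submission where

-- By ee-density, the link of all but few vertices ("good" ones) is dense on every vertex set A of linear size,
-- and nothing else about the hypergraph is used. Assertions "for linearly many x, for linearly many y, ..." may be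
-- reordered by double counting, and one colour class survives every bounded colouring, at the cost of constants.
--
-- For b + k ≤ r, induction on k shows: given b blocks of good vertices, every set of linear size contains many copies
-- of K_{2^k} whose pairs lie in the links of a fixed proportion of each block, where this proportion does not
-- depend on the sizes of the blocks. For the step, b (1 - d) < 1 implies that for linearly many y there are linearly
-- many z such that the pair y z lies in the links of a fixed proportion of each block. With {y} as an additional
-- block, replace z by a bounded set Y each of whose large subsets contains a suitable K_{2^k}. Linearly many y share
-- the same Y and the same trace of their links on Y. Among these y find a K_{2^k} with Y as an additional block: its
-- pairs lie in the links of a large subset of Y, which contains a second K_{2^k}, and both form a K_{2^{k+1}}.

open import Defs
open import Data.Bool using (Bool; true; false; not; _∧_; T)
open import Data.Bool.ListAction using (all)
import Data.Bool.Properties as Bool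
open import Data.Empty using (⊥)
open import Data.Fin using (Fin; zero; suc)
import Data.Fin.Properties as Fin
open import Data.Fin.Subset.Properties using (anySubset?)
import Data.Integer as ℤ
open import Data.Integer using (ℤ) renaming (+_ to pos)
import Data.Integer.Properties as ℤ
import Data.Integer.Tactic.RingSolver as ℤ
open import Data.List as List using (List; []; _∷_; _++_; concat; length; filter; cartesianProduct; allFin)
open import Data.List.Membership.Propositional using (_∈_)
open import Data.List.Membership.Propositional.Properties
  using (∈-++⁺ˡ; ∈-++⁺ʳ; ∈-++⁻; ∈-filter⁺; ∈-filter⁻; ∈-cartesianProduct⁺; ∈-lookup)
open import Data.List.Properties using (length-++; length-map; length-tabulate)
open import Data.List.Relation.Binary.Pointwise using (Pointwise; []; _∷_)
open import Data.List.Relation.Binary.Sublist.Heterogeneous.Properties using (length-mono-≤)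
open import Data.List.Relation.Binary.Sublist.Propositional as Sublist using (_⊆_; []; _∷_; _∷ʳ_; ⊆-refl; ⊆-trans)
open import Data.List.Relation.Binary.Sublist.Propositional.Properties using (All-resp-⊆; filter-⊆)
open import Data.List.Relation.Unary.All as All using (All; []; _∷_)
import Data.List.Relation.Unary.All.Properties as All
open import Data.List.Relation.Unary.AllPairs using (AllPairs; []; _∷_)
import Data.List.Relation.Unary.AllPairs.Properties as AllPairs
open import Data.List.Relation.Unary.Any using (here)
open import Data.Nat
open import Data.Nat.ListAction using (sum)
open import Data.Nat.Properties
open import Data.Nat.Tactic.RingSolver using (solve-∀)
open import Data.Product using (Σ; _×_; _,_; proj₁; proj₂)
import Data.Rational as ℚ
open import Data.Rational using (ℚ; mkℚ; toℚᵘ; Positive)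
import Data.Rational.Properties as ℚ
import Data.Rational.Unnormalised as ℚᵘ
open import Data.Rational.Unnormalised using (mkℚᵘ; _≃_)
import Data.Rational.Unnormalised.Properties as ℚᵘ
open import Data.Sum using (_⊎_; inj₁; inj₂)
open import Data.Unit using (⊤; tt)
open import Data.Vec using (lookup; tabulate)
open import Data.Vec.Properties using (lookup∘tabulate)
open import Function using (_∘_; id)
open import Function.Definitions using (Injective)
open import Relation.Binary.PropositionalEquality
open import Relation.Nullary using (yes; no; contradiction)
open import Relation.Nullary.Decidable using (_×-dec_)

-- Sums and linearly many vertices

∑ : {A : Set} → List A → (A → ℕ) → ℕ
∑ xs f = sum (List.map f xs)

∑-cong : ∀ {A : Set} {f g : A → ℕ} xs → (∀ x → f x ≡ g x) → ∑ xs f ≡ ∑ xs g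
∑-cong []       f≡g = refl
∑-cong (x ∷ xs) f≡g = cong₂ _+_ (f≡g x) (∑-cong xs f≡g)

∑-mono-≤ : ∀ {A : Set} {f g : A → ℕ} xs → (∀ x → f x ≤ g x) → ∑ xs f ≤ ∑ xs g
∑-mono-≤ []       f≤g = z≤n
∑-mono-≤ (x ∷ xs) f≤g = +-mono-≤ (f≤g x) (∑-mono-≤ xs f≤g)

∑-+ : ∀ {A : Set} (f g : A → ℕ) xs → ∑ xs (λ x → f x + g x) ≡ ∑ xs f + ∑ xs g
∑-+ f g []       = refl
∑-+ f g (x ∷ xs) = trans (cong (f x + g x +_) (∑-+ f g xs)) (interchange (f x) (g x) (∑ xs f) (∑ xs g))
  where
  interchange : ∀ a b c d → a + b + (c + d) ≡ a + c + (b + d)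
  interchange = solve-∀

∑-* : ∀ {A : Set} c (f : A → ℕ) xs → ∑ xs (λ x → c * f x) ≡ c * ∑ xs f
∑-* c f []       = sym (*-zeroʳ c)
∑-* c f (x ∷ xs) = trans (cong (c * f x +_) (∑-* c f xs)) (sym (*-distribˡ-+ c (f x) (∑ xs f)))

∑-const : ∀ {A : Set} c (xs : List A) → ∑ xs (λ _ → c) ≡ length xs * c
∑-const c []       = refl
∑-const c (x ∷ xs) = cong (c +_) (∑-const c xs)

∑-swap : ∀ {A B : Set} (f : A → B → ℕ) xs ys →
         ∑ xs (λ x → ∑ ys (f x)) ≡ ∑ ys (λ y → ∑ xs (λ x → f x y))
∑-swap f []       ys = sym (trans (∑-const 0 ys) (*-zeroʳ (length ys)))
∑-swap f (x ∷ xs) ys = trans (cong (∑ ys (f x) +_) (∑-swap f xs ys))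
                             (sym (∑-+ (f x) (λ y → ∑ xs (λ x → f x y)) ys))

ΣFin-const : ∀ n c → ΣFin n (λ _ → c) ≡ n * c
ΣFin-const n c = trans (∑-const c (allFin n)) (cong (_* c) (length-tabulate {n = n} (λ i → i)))

card : ∀ {n} → (Fin n → Bool) → ℕ
card {n} A = ΣFin n (λ x → 𝟙 (A x))

𝟙≤1 : ∀ b → 𝟙 b ≤ 1
𝟙≤1 true  = ≤-refl
𝟙≤1 false = z≤n

card≤n : ∀ {n} (A : Fin n → Bool) → card A ≤ n
card≤n {n} A = ≤-trans (∑-mono-≤ (allFin n) (λ x → 𝟙≤1 (A x))) (≤-reflexive (trans (ΣFin-const n 1) (*-identityʳ n)))

card-witness : ∀ {n} (A : Fin n → Bool) → 1 ≤ card A → Σ (Fin n) λ x → A x ≡ true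
card-witness {n} A = go (allFin n)
  where
  go : ∀ xs → 1 ≤ ∑ xs (λ x → 𝟙 (A x)) → Σ (Fin n) λ x → A x ≡ true
  go (x ∷ xs) p with A x in eq
  ... | true  = x , eq
  ... | false = go xs p

-- `P` need not be decidable, so the linearly many elements are exhibited as a Boolean set of
-- density at least `1 / K`. A larger `K` is a weaker claim.
record Many {n : ℕ} (K : ℕ) (P : Fin n → Set) : Set where
  constructor many-by
  field
    subset : Fin n → Bool
    large  : n ≤ K * card subset
    sound  : ∀ x → subset x ≡ true → P x

many-map : ∀ {n K} {P Q : Fin n → Set} → (∀ x → P x → Q x) → Many K P → Many K Q
many-map h (many-by A A-large f) = many-by A A-large λ x eq → h x (f x eq)

-- Averaging: rows with fewer than `n / (2 * K)` entries hold at most half of the guaranteed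
-- `n * n / K` entries, and a row holds at most `n`, so the other half needs `n / (2 * K)` rows.
many-rows : ∀ {n} K (M : Fin n → Fin n → Bool) →
            n * n ≤ K * ΣFin n (λ x → card (M x)) →
            Many (2 * K) (λ x → n ≤ 2 * K * card (M x))
many-rows {n} K M dense = many-by A large A-sound
  where
  A : Fin n → Bool
  A x = n ≤ᵇ 2 * K * card (M x)
  A-sound : ∀ x → A x ≡ true → n ≤ 2 * K * card (M x)
  A-sound x eq = ≤ᵇ⇒≤ n _ (subst T (sym eq) tt)
  row : ∀ x → 2 * K * card (M x) ≤ 2 * K * n * 𝟙 (A x) + n
  row x with A x in eq
  ... | true  = ≤-trans (*-monoʳ-≤ (2 * K) (card≤n (M x)))
                        (≤-trans (≤-reflexive (sym (*-identityʳ (2 * K * n)))) (m≤m+n _ n))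
  ... | false = ≤-trans (<⇒≤ (≰⇒> (λ le → subst T eq (≤⇒≤ᵇ le)))) (m≤n+m n _)
  total : 2 * (n * n) ≤ 2 * K * n * card A + n * n
  total = begin
    2 * (n * n)                                    ≤⟨ *-monoʳ-≤ 2 dense ⟩
    2 * (K * ΣFin n (λ x → card (M x)))            ≡⟨ *-assoc 2 K _ ⟨
    2 * K * ΣFin n (λ x → card (M x))              ≡⟨ ∑-* (2 * K) _ (allFin n) ⟨
    ΣFin n (λ x → 2 * K * card (M x))              ≤⟨ ∑-mono-≤ (allFin n) row ⟩
    ΣFin n (λ x → 2 * K * n * 𝟙 (A x) + n)         ≡⟨ ∑-+ _ _ (allFin n) ⟩
    ΣFin n (λ x → 2 * K * n * 𝟙 (A x)) + ΣFin n (λ _ → n)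
      ≡⟨ cong₂ _+_ (∑-* (2 * K * n) _ (allFin n)) (ΣFin-const n n) ⟩
    2 * K * n * card A + n * n                     ∎
    where open ≤-Reasoning
  square : n * n ≤ n * (2 * K * card A)
  square = +-cancelʳ-≤ (n * n) _ _ (≤-trans (≤-reflexive (e₁ n)) (≤-trans total (≤-reflexive (e₂ n K (card A)))))
    where
    e₁ : ∀ n → n * n + n * n ≡ 2 * (n * n)
    e₁ = solve-∀
    e₂ : ∀ n K a → 2 * K * n * a + n * n ≡ n * (2 * K * a) + n * n
    e₂ = solve-∀
  large : n ≤ 2 * K * card A
  large = cancel n square
    where
    cancel : ∀ m {a} → m * m ≤ m * a → m ≤ a
    cancel zero    _ = z≤n
    cancel (suc m) p = *-cancelˡ-≤ (suc m) p

-- Double counting: the matrix of chosen pairs has density at least `1 / (K * K)`, and `many-rows`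
-- is applied to its transpose.
many-swap : ∀ {n} K {P : Fin n → Fin n → Set} →
            Many K (λ x → Many K (P x)) →
            Many (2 * (K * K)) (λ y → Many (2 * (K * K)) (λ x → P x y))
many-swap {n} K {P} (many-by A A-large f) =
  many-map (λ y y-large → many-by (λ x → M x y) y-large λ x → M-sound x y)
    (many-rows (K * K) (λ y x → M x y) dense)
  where
  row : ∀ x → Σ (Fin n → Bool) λ B → (n * 𝟙 (A x) ≤ K * card B) × (∀ y → B y ≡ true → P x y)
  row x with A x in eq
  ... | true  = let many-by B B-large g = f x eq in B , ≤-trans (≤-reflexive (*-identityʳ n)) B-large , g
  ... | false = (λ _ → false) , ≤-trans (≤-reflexive (*-zeroʳ n)) z≤n , λ _ ()
  M : Fin n → Fin n → Bool
  M x = proj₁ (row x)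
  M-sound : ∀ x y → M x y ≡ true → P x y
  M-sound x = proj₂ (proj₂ (row x))
  dense : n * n ≤ K * K * ΣFin n (λ y → card (λ x → M x y))
  dense = begin
    n * n                                  ≤⟨ *-monoʳ-≤ n A-large ⟩
    n * (K * card A)                       ≡⟨ e n K (card A) ⟩
    K * (n * card A)                       ≡⟨ cong (K *_) (∑-* n _ (allFin n)) ⟨
    K * ΣFin n (λ x → n * 𝟙 (A x))         ≤⟨ *-monoʳ-≤ K (∑-mono-≤ (allFin n) (λ x → proj₁ (proj₂ (row x)))) ⟩
    K * ΣFin n (λ x → K * card (M x))      ≡⟨ cong (K *_) (∑-* K _ (allFin n)) ⟩
    K * (K * ΣFin n (λ x → card (M x)))    ≡⟨ *-assoc K K _ ⟨
    K * K * ΣFin n (λ x → card (M x))      ≡⟨ cong (K * K *_) (∑-swap (λ x y → 𝟙 (M x y)) (allFin n) (allFin n)) ⟩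
    K * K * ΣFin n (λ y → card (λ x → M x y)) ∎
    where
    open ≤-Reasoning
    e : ∀ n K a → n * (K * a) ≡ K * (n * a)
    e = solve-∀

many-split : ∀ {n} K {P Q : Fin n → Set} → Many K (λ x → P x ⊎ Q x) → Many (2 * K) P ⊎ Many (2 * K) Q
many-split {n} K {P} {Q} (many-by A A-large f) = choose (≤-total (card A₂) (card A₁))
  where
  side : ∀ x → Σ Bool λ l → Σ Bool λ r →
         (𝟙 (A x) ≤ 𝟙 l + 𝟙 r) × (l ≡ true → P x) × (r ≡ true → Q x)
  side x with A x in eq
  ... | false = false , false , z≤n , (λ ()) , λ ()
  ... | true with f x eq
  ...   | inj₁ p = true , false , ≤-refl , (λ _ → p) , λ ()
  ...   | inj₂ q = false , true , ≤-refl , (λ ()) , λ _ → q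
  A₁ A₂ : Fin n → Bool
  A₁ x = proj₁ (side x)
  A₂ x = proj₁ (proj₂ (side x))
  covers : card A ≤ card A₁ + card A₂
  covers = ≤-trans (∑-mono-≤ (allFin n) (λ x → proj₁ (proj₂ (proj₂ (side x)))))
                   (≤-reflexive (∑-+ _ _ (allFin n)))
  half : ∀ {a b} → b ≤ a → card A ≤ a + b → n ≤ 2 * K * a
  half {a} {b} b≤a le = begin
    n            ≤⟨ A-large ⟩
    K * card A   ≤⟨ *-monoʳ-≤ K (≤-trans le (+-monoʳ-≤ a b≤a)) ⟩
    K * (a + a)  ≡⟨ e K a ⟩
    2 * K * a    ∎
    where
    open ≤-Reasoning
    e : ∀ K a → K * (a + a) ≡ 2 * K * a
    e = solve-∀
  choose : card A₂ ≤ card A₁ ⊎ card A₁ ≤ card A₂ → Many (2 * K) P ⊎ Many (2 * K) Q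
  choose (inj₁ le) = inj₁ (many-by A₁ (half le covers) λ x → proj₁ (proj₂ (proj₂ (proj₂ (side x)))))
  choose (inj₂ le) = inj₂ (many-by A₂ (half le (≤-trans covers (≤-reflexive (+-comm (card A₁) (card A₂)))))
                                      λ x → proj₂ (proj₂ (proj₂ (proj₂ (side x)))))

many-mono : ∀ {n K K′} {P : Fin n → Set} → K ≤ K′ → Many K P → Many K′ P
many-mono le (many-by A A-large f) = many-by A (≤-trans A-large (*-monoˡ-≤ (card A) le)) f

many-witness : ∀ {n K} {P : Fin n → Set} → 1 ≤ n → Many K P → Σ (Fin n) P
many-witness {n} {K} 1≤n (many-by A A-large f) =
  let (x , eq) = card-witness A (positive (card A) (≤-trans 1≤n A-large)) in x , f x eq
  where
  positive : ∀ a → 1 ≤ K * a → 1 ≤ a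
  positive zero    le = contradiction (≤-trans le (≤-reflexive (*-zeroʳ K))) λ ()
  positive (suc a) le = s≤s z≤n

-- Iterated quantifiers over linearly many objects

-- An abstract quantifier "for linearly many", so that vertices, tuples and tuples of tuples share
-- the arguments below. `split` is the form of the pigeonhole principle that passes through
-- iteration.
record Modality (X : ℕ → Set) : Set₁ where
  field
    Holds   : ∀ {n} → ℕ → (X n → Set) → Set
    map     : ∀ {n K} {P Q : X n → Set} → (∀ x → P x → Q x) → Holds K P → Holds K Q
    mono    : ∀ {n K K′} {P : X n → Set} → K ≤ K′ → Holds K P → Holds K′ P
    split   : ∀ {n} K {P Q : X n → Set} → Holds K (λ x → P x ⊎ Q x) → Holds (2 * K) P ⊎ Holds (2 * K) Q
    witness : ∀ {n K} {P : X n → Set} → 1 ≤ n → Holds K P → Σ (X n) P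
open Modality

many : Modality Fin
many = record
  { Holds = Many ; map = many-map ; mono = many-mono ; split = many-split ; witness = many-witness }

module _ {X} (F : Modality X) where

  -- Quantifiers are nested instead of asking for a dense set of `q`-tuples: the candidates for an
  -- entry may depend on the earlier entries, and fixing the first entry leaves a statement of the
  -- same kind.
  iterated : ∀ {n} → ℕ → ℕ → (List (X n) → Set) → Set
  iterated zero    K P = P []
  iterated (suc q) K P = Holds F K λ x → iterated q K λ xs → P (x ∷ xs)

  iterated-map : ∀ q {n K} {P Q : List (X n) → Set} → (∀ x → P x → Q x) → iterated q K P → iterated q K Q
  iterated-map zero    h = h []
  iterated-map (suc q) h = map F λ x → iterated-map q λ xs → h (x ∷ xs)

  iterated-mono : ∀ q {n K K′} {P : List (X n) → Set} → K ≤ K′ → iterated q K P → iterated q K′ P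
  iterated-mono zero    le = id
  iterated-mono (suc q) le = mono F le ∘ map F λ x → iterated-mono q le

  iterated-split : ∀ q {n} K {P Q : List (X n) → Set} → iterated q K (λ x → P x ⊎ Q x) →
                   iterated q (2 * K) P ⊎ iterated q (2 * K) Q
  iterated-split zero    K = id
  iterated-split (suc q) K = split F K ∘ map F λ x → iterated-split q K

  iterated-witness : ∀ q {n K} {P : List (X n) → Set} → 1 ≤ n → iterated q K P → Σ (List (X n)) P
  iterated-witness zero    1≤n p = [] , p
  iterated-witness (suc q) 1≤n p =
    let (x , p′) = witness F 1≤n p ; (xs , p″) = iterated-witness q 1≤n p′ in x ∷ xs , p″

iter : ∀ {X} → Modality X → ℕ → Modality (List ∘ X)
iter F q = record
  { Holds   = iterated F q
  ; map     = iterated-map F q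
  ; mono    = iterated-mono F q
  ; split   = iterated-split F q
  ; witness = iterated-witness F q
  }

SwapsAt : ∀ {X Y} → Modality X → Modality Y → ℕ → ℕ → Set₁
SwapsAt {X} {Y} F G K K′ = ∀ {n} {P : X n → Y n → Set} →
  Holds F K (λ x → Holds G K (P x)) → Holds G K′ (λ y → Holds F K′ (λ x → P x y))

-- `factor` does not depend on `n`, so a bounded number of exchanges costs only constants.
-- `inflation` lets all quantifiers involved be weakened to a common density.
record Swap {X Y} (F : Modality X) (G : Modality Y) : Set₁ where
  field
    factor    : ℕ → ℕ
    inflation : ∀ K → K ≤ factor K
    swap      : ∀ K → SwapsAt F G K (factor K)
open Swap

swap-many : Swap many many
swap-many = record
  { factor = λ K → 2 * (K * K) ; inflation = infl ; swap = λ K → many-swap K }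
  where
  infl : ∀ K → K ≤ 2 * (K * K)
  infl zero      = z≤n
  infl K@(suc _) = ≤-trans (m≤m*n K K) (m≤n*m (K * K) 2)

swap-iterʳ : ∀ {X Y} {F : Modality X} {G : Modality Y} → Swap F G → ∀ q → Swap F (iter G q)
swap-iterʳ S zero = record { factor = id ; inflation = λ _ → ≤-refl ; swap = λ K p → p }
swap-iterʳ {F = F} {G} S (suc q) = record
  { factor    = λ K → factor S′ (factor S K)
  ; inflation = λ K → ≤-trans (inflation S K) (inflation S′ _)
  ; swap      = λ K p →
      mono G (inflation S′ _) (map G (λ y → swap S′ (factor S K))
        (swap S K (map F (λ x → map G λ y → mono (iter G q) (inflation S K)) p)))
  }
  where S′ = swap-iterʳ S q

swap-iterˡ : ∀ {X Y} {F : Modality X} {G : Modality Y} → Swap F G → ∀ q → Swap (iter F q) G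
swap-iterˡ S zero = record { factor = id ; inflation = λ _ → ≤-refl ; swap = λ K p → p }
swap-iterˡ {F = F} {G} S (suc q) = record
  { factor    = λ K → factor S (factor S′ K)
  ; inflation = λ K → ≤-trans (inflation S′ K) (inflation S _)
  ; swap      = λ K p →
      map G (λ y → map F λ x → mono (iter F q) (inflation S _))
        (swap S (factor S′ K) (mono F (inflation S′ K) (map F (λ x → swap S′ K) p)))
  }
  where S′ = swap-iterˡ S q

-- Pigeonhole principles and concatenation of tuples

doubled : ∀ l K → 2 ^ l * (2 * K) ≤ 2 ^ suc l * K
doubled l K = ≤-reflexive (trans (sym (*-assoc (2 ^ l) 2 K)) (cong (_* K) (*-comm (2 ^ l) 2)))

module _ {X} (F : Modality X) where

  -- The sublist is a colour with `2 ^ length o` values. It is fixed entry by entry: `split` decides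
  -- whether the entry is kept, and each decision doubles the constant.
  pigeonhole-⊆ : ∀ {A : Set} {n} K (o : List A) {P : List A → X n → Set} →
                 Holds F K (λ x → Σ (List A) λ t → t ⊆ o × P t x) →
                 Σ (List A) λ t → t ⊆ o × Holds F (2 ^ length o * K) (P t)
  pigeonhole-⊆ K [] {P} p =
    [] , [] , mono F (≤-reflexive (sym (+-identityʳ K))) (map F (λ { x ([] , [] , p) → p }) p)
  pigeonhole-⊆ {A} {n} K (a ∷ o) {P} p with split F K (map F cases p)
    where
    cases : ∀ x → (Σ (List A) λ t → t ⊆ a ∷ o × P t x) →
            (Σ (List A) λ t → t ⊆ o × P t x) ⊎ (Σ (List A) λ t → t ⊆ o × P (a ∷ t) x)
    cases x (t     , .a ∷ʳ s  , p) = inj₁ (t , s , p)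
    cases x (_ ∷ t , refl ∷ s , p) = inj₂ (t , s , p)
  ... | inj₁ p′ = let (t , s , p″) = pigeonhole-⊆ (2 * K) o p′ in t , a ∷ʳ s , mono F (doubled (length o) K) p″
  ... | inj₂ p′ = let (t , s , p″) = pigeonhole-⊆ (2 * K) o p′ in a ∷ t , refl ∷ s , mono F (doubled (length o) K) p″

  iter-length : ∀ {n K} q {P : List (X n) → Set} →
                Holds (iter F q) K P → Holds (iter F q) K (λ xs → length xs ≡ q × P xs)
  iter-length zero    p = refl , p
  iter-length (suc q) p = map F (λ x p → map (iter F q) (λ xs (e , p) → cong suc e , p) (iter-length q p)) p

  iter-++ : ∀ {n K} a b {P : List (X n) → Set} →
            Holds (iter F a) K (λ xs → Holds (iter F b) K (λ ys → P (xs ++ ys))) →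
            Holds (iter F (a + b)) K P
  iter-++ zero    b p = p
  iter-++ (suc a) b p = map F (λ x → iter-++ a b) p

  iter-concat : ∀ {n K} q M {P : List (X n) → Set} →
                Holds (iter (iter F M) q) K (P ∘ concat) → Holds (iter F (q * M)) K P
  iter-concat zero    M p = p
  iter-concat (suc q) M p = iter-++ M (q * M) (map (iter F M) (λ ys → iter-concat q M) p)

-- Blocks, cliques and robust sets

⊆-++⁻ : ∀ {A : Set} {U : List A} xs {ys} → U ⊆ xs ++ ys →
        Σ (List A) λ V → Σ (List A) λ W → U ≡ V ++ W × V ⊆ xs × W ⊆ ys
⊆-++⁻ []       s           = [] , _ , refl , [] , s
⊆-++⁻ (x ∷ xs) (.x ∷ʳ s)   = let (V , W , e , s₁ , s₂) = ⊆-++⁻ xs s in V , W , e , x ∷ʳ s₁ , s₂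
⊆-++⁻ (x ∷ xs) (refl ∷ s) = let (V , W , e , s₁ , s₂) = ⊆-++⁻ xs s in x ∷ V , W , cong (x ∷_) e , refl ∷ s₁ , s₂

Blocks : Set → Set
Blocks A = List (List A)

size : ∀ {A} → Blocks A → ℕ
size Ω = ∑ Ω length

-- Repeated vertices count with multiplicity, so a tuple can serve as a block without a check that
-- its entries differ.
data _⊑[_]_ {A : Set} : Blocks A → ℕ → Blocks A → Set where
  []  : ∀ {B} → [] ⊑[ B ] []
  _∷_ : ∀ {B t o T Ω} → t ⊆ o × length o ≤ B * length t → T ⊑[ B ] Ω → (t ∷ T) ⊑[ B ] (o ∷ Ω)

AllBlocks : ∀ {A} → (A → Set) → Blocks A → Set
AllBlocks P = All (All P)

⊑-refl : ∀ {A} (Ω : Blocks A) → Ω ⊑[ 1 ] Ω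
⊑-refl []      = []
⊑-refl (o ∷ Ω) = (⊆-refl , ≤-reflexive (sym (*-identityˡ _))) ∷ ⊑-refl Ω

⊑-trans : ∀ {A B C} {T Ω Ξ : Blocks A} → T ⊑[ B ] Ω → Ω ⊑[ C ] Ξ → T ⊑[ C * B ] Ξ
⊑-trans [] [] = []
⊑-trans {B = B} {C} (_∷_ {t = t} (s₁ , l₁) r₁) ((s₂ , l₂) ∷ r₂) =
  (⊆-trans s₁ s₂ , ≤-trans l₂ (≤-trans (*-monoʳ-≤ C l₁) (≤-reflexive (sym (*-assoc C B (length t)))))) ∷ ⊑-trans r₁ r₂

⊑-size : ∀ {A B} {T Ω : Blocks A} → T ⊑[ B ] Ω → size T ≤ size Ω
⊑-size []             = z≤n
⊑-size ((s , _) ∷ r) = +-mono-≤ (length-mono-≤ s) (⊑-size r)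

⊑-length : ∀ {A B} {T Ω : Blocks A} → T ⊑[ B ] Ω → length T ≡ length Ω
⊑-length []      = refl
⊑-length (_ ∷ r) = cong suc (⊑-length r)

⊑-All : ∀ {A B} {T Ω : Blocks A} {P : A → Set} → T ⊑[ B ] Ω → AllBlocks P Ω → AllBlocks P T
⊑-All []             []       = []
⊑-All ((s , _) ∷ r) (p ∷ ps) = All-resp-⊆ s p ∷ ⊑-All r ps

pigeonhole-⊑ : ∀ {X} (F : Modality X) {A n} → 1 ≤ n → ∀ K {B} (Ω : Blocks A) {P : Blocks A → X n → Set} →
               Holds F K (λ x → Σ (Blocks A) λ T → T ⊑[ B ] Ω × P T x) →
               Σ (Blocks A) λ T → T ⊑[ B ] Ω × Holds F (2 ^ size Ω * K) (P T)
pigeonhole-⊑ F 1≤n K [] p =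
  [] , [] , mono F (≤-reflexive (sym (*-identityˡ K))) (map F (λ { x ([] , [] , p) → p }) p)
pigeonhole-⊑ F {A} {n} 1≤n K {B} (o ∷ Ω) {P} p =
  let (t , t⊆o , p₁) = pigeonhole-⊆ F K o (map F regroup p)
      -- The density of `t` does not depend on the quantified object but is known only under the
      -- quantifier; one witness, which exists because `n` is positive, releases it.
      (_ , (_ , dense , _)) = witness F 1≤n p₁
      (T , T⊑Ω , p₂) = pigeonhole-⊑ F 1≤n (2 ^ length o * K) Ω
                         (map F (λ x (T , _ , T⊑Ω , p) → T , T⊑Ω , p) p₁)
  in t ∷ T , (t⊆o , dense) ∷ T⊑Ω , mono F (≤-reflexive (e (size Ω) (length o) K)) p₂
  where
  regroup : ∀ x → (Σ (Blocks A) λ T → T ⊑[ B ] (o ∷ Ω) × P T x) →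
            Σ (List A) λ t → t ⊆ o × Σ (Blocks A) λ T → length o ≤ B * length t × T ⊑[ B ] Ω × P (t ∷ T) x
  regroup x (t ∷ T , (s , d) ∷ r , p) = t , s , T , d , r , p
  e : ∀ a b K → 2 ^ a * (2 ^ b * K) ≡ 2 ^ (b + a) * K
  e a b K = trans (sym (*-assoc (2 ^ a) (2 ^ b) K))
                  (cong (_* K) (trans (*-comm (2 ^ a) (2 ^ b)) (sym (^-distribˡ-+-* 2 b a))))

Edge : ∀ {n} → Hypergraph3 n → Fin n → Fin n → Fin n → Set
Edge H x y z = edge H x y z ≡ true

edge-swap₁₂ : ∀ {n} (H : Hypergraph3 n) {x y z} → Edge H x y z → Edge H y x z
edge-swap₁₂ H {x} {y} {z} e = trans (sym (sym₁₂ H x y z)) e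

edge-swap₂₃ : ∀ {n} (H : Hypergraph3 n) {x y z} → Edge H x y z → Edge H x z y
edge-swap₂₃ H {x} {y} {z} e = trans (sym (sym₂₃ H x y z)) e

Clique : ∀ {n} → Hypergraph3 n → List (Fin n) → Set
Clique H []       = ⊤
Clique H (x ∷ xs) = AllPairs (Edge H x) xs × Clique H xs

-- A triple of the concatenation lies within one list or has one vertex in one list and two in the
-- other; the last two hypotheses treat the two mixed kinds.
clique-++ : ∀ {n} (H : Hypergraph3 n) {xs ys} → Clique H xs → Clique H ys →
            All (λ x → AllPairs (Edge H x) ys) xs → All (λ y → AllPairs (Edge H y) xs) ys → Clique H (xs ++ ys)
clique-++ H {[]}     cx        cy []       q = cy
clique-++ H {x ∷ xs} (px , cx) cy (p ∷ ps) q =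
  AllPairs.++⁺ px p (All.tabulate λ x′∈ → All.map (λ { (h ∷ _) → edge-swap₂₃ H (edge-swap₁₂ H (All.lookup h x′∈)) }) q)
  , clique-++ H cx cy ps (All.map (λ { (_ ∷ h) → h }) q)

-- Degenerate pairs, with `y = z` or an entry equal to `x`, count as missing, in accordance with
-- `Kcount`, which counts them too.
missing : ∀ {n} → Hypergraph3 n → Fin n → (Fin n → Bool) → ℕ
missing {n} H x A = ΣFin n λ y → ΣFin n λ z → 𝟙 (A y) * 𝟙 (A z) * 𝟙 (not (edge H x y z))

-- On every A of size at least n / K, the link of x has relative density at least 1 - σ / (R (2 + σ)), where R = r - 1.
record Good (R σ : ℕ) {n : ℕ} (H : Hypergraph3 n) (K : ℕ) (x : Fin n) : Set where
  constructor good-by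
  field
    dense-link : ∀ A → n ≤ K * card A → R * (2 + σ) * missing H x A ≤ σ * (card A * card A)

-- A larger `K` also tests smaller sets `A`, so goodness grows stronger with `K`, contrary to
-- `Many`.
good-anti : ∀ {R σ n} {H : Hypergraph3 n} {K K′} → K ≤ K′ → ∀ {x} → Good R σ H K′ x → Good R σ H K x
good-anti le (good-by g) = good-by λ A large → g A (≤-trans large (*-monoˡ-≤ (card A) le))

record Has {n : ℕ} (H : Hypergraph3 n) (k : ℕ) (T : Blocks (Fin n)) (S : List (Fin n)) : Set where
  constructor has
  field
    vertices  : List (Fin n)
    number    : length vertices ≡ 2 ^ k
    inside    : All (_∈ S) vertices
    clique    : Clique H vertices
    in-links  : AllBlocks (λ ω → AllPairs (Edge H ω) vertices) T

has-mono : ∀ {n} {H : Hypergraph3 n} {k T S S′} → (∀ {x} → x ∈ S → x ∈ S′) → Has H k T S → Has H k T S′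
has-mono S⊆S′ (has Q l s c t) = has Q l (All.map S⊆S′ s) c t

has-anti : ∀ {n} {H : Hypergraph3 n} {k B T T′ S} → T′ ⊑[ B ] T → Has H k T S → Has H k T′ S
has-anti r (has Q l s c t) = has Q l s c (⊑-All r t)

Robust : ∀ {n} → Hypergraph3 n → ℕ → ℕ → Blocks (Fin n) → List (Fin n) → Set
Robust H k c T Y = ∀ U → U ⊆ Y → c < length U → Has H k T U

-- Three cases: `U` meets some member of `Yss` in more than `c` entries; it meets every member,
-- which gives a transversal inside `U`; or it misses a member, which saves `c` in the count. `P` is
-- arbitrary so that the induction can absorb the entries already chosen.
robust-concat : ∀ {n} (H : Hypergraph3 n) k c T Yss {P : List (Fin n) → Set} →
                All (Robust H k c T) Yss → (∀ {xs} → Pointwise _∈_ xs Yss → P xs) →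
                ∀ {U} → U ⊆ concat Yss →
                Has H k T U ⊎
                (Σ (List (Fin n)) λ xs → All (_∈ U) xs × P xs × length U ≤ length Yss * c) ⊎
                length U + c ≤ length Yss * c
robust-concat H k c T [] [] tr [] = inj₂ (inj₁ ([] , [] , tr [] , z≤n))
robust-concat H k c T (Y ∷ Yss) {P} (ρ ∷ ρs) tr U⊆ with ⊆-++⁻ Y U⊆
... | V , W , refl , V⊆Y , W⊆ with c <? length V
...   | yes big = inj₁ (has-mono ∈-++⁺ˡ (ρ V V⊆Y big))
...   | no ¬big with robust-concat H k c T Yss {λ xs → ∀ {y} → y ∈ Y → P (y ∷ xs)} ρs (λ t y∈ → tr (y∈ ∷ t)) W⊆
...     | inj₁ h = inj₁ (has-mono (∈-++⁺ʳ V) h)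
...     | inj₂ (inj₂ few) = inj₂ (inj₂ (≤-trans (≤-reflexive (trans (cong (_+ c) (length-++ V)) (+-assoc (length V) _ c)))
                                              (+-mono-≤ (≮⇒≥ ¬big) few)))
...     | inj₂ (inj₁ (xs , xs⊆W , p , le)) with V | V⊆Y
...       | []     | _    = inj₂ (inj₂ (≤-trans (≤-reflexive (+-comm (length W) c)) (+-monoʳ-≤ c le)))
...       | v ∷ V′ | V⊆Y′ = inj₂ (inj₁ (v ∷ xs , here refl ∷ All.map (∈-++⁺ʳ (v ∷ V′)) xs⊆W , p (Sublist.lookup V⊆Y′ (here refl)) ,
                              ≤-trans (≤-reflexive (length-++ (v ∷ V′))) (+-mono-≤ (≮⇒≥ ¬big) le)))

-- Building robust sets from copies

tuples : ℕ → Modality (List ∘ Fin)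
tuples m = iter many m

module _ (R σ : ℕ) where

  -- `K′` is both the scale at which the vertices have to be good and the density of the tuples
  -- found.
  FindsAt : ℕ → ℕ → (∀ {n} → Hypergraph3 n → Blocks (Fin n) → List (Fin n) → Set) → ℕ → ℕ → ℕ → ℕ → Set
  FindsAt b m Φ B w K K′ = ∀ {n} → 1 ≤ n → (H : Hypergraph3 n) (N : Fin n → Bool) → n ≤ K * card N →
    (∀ x → N x ≡ true → Good R σ H K′ x) →
    (Ω : Blocks (Fin n)) → length Ω ≡ b → size Ω ≤ w → AllBlocks (Good R σ H K′) Ω →
    Σ (Blocks (Fin n)) λ T → T ⊑[ B ] Ω ×
    Holds (tuples m) K′ (λ Z → All (λ x → N x ≡ true) Z × Φ H T Z)

  -- `B` is chosen before the bound `w` on the total size of the blocks. Doubling relies on this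
  -- order, since it adds a block whose size is chosen in terms of `B`.
  Finds : ℕ → ℕ → (∀ {n} → Hypergraph3 n → Blocks (Fin n) → List (Fin n) → Set) → Set
  Finds b m Φ = Σ ℕ λ B → ∀ w K → Σ ℕ λ K′ → FindsAt b m Φ B w K K′

  module _ {b M : ℕ} {Ψ : ∀ {n} → Hypergraph3 n → Blocks (Fin n) → List (Fin n) → Set}
           (Ψ-anti : ∀ {n} {H : Hypergraph3 n} {B T T′ Y} → T′ ⊑[ B ] T → Ψ H T Y → Ψ H T′ Y)
           where

    -- A blow-up: every entry of a tuple is replaced by an `M`-tuple with `Ψ` so that all
    -- transversals keep the property `P`. The blocks shrink on the way, hence `P` has to be
    -- inherited by smaller blocks.
    SubstitutesAt : ℕ → ℕ → ℕ → ℕ → ℕ → Set₁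
    SubstitutesAt q B w K K′ =
      ∀ {n} → 1 ≤ n → (H : Hypergraph3 n) {Q : Fin n → Set} →
      (∀ x → Q x → Good R σ H K′ x) →
      (Ω : Blocks (Fin n)) → length Ω ≡ b → size Ω ≤ w → AllBlocks (Good R σ H K′) Ω →
      {P : List (Fin n) → Blocks (Fin n) → Set} →
      (∀ {B T T′ xs} → T′ ⊑[ B ] T → P xs T → P xs T′) →
      Holds (tuples q) K (λ xs → All Q xs × P xs Ω) →
      Σ (Blocks (Fin n)) λ T → T ⊑[ B ] Ω ×
      Holds (iter (tuples M) q) K′ (λ Yss → All (λ Y → All Q Y × Ψ H T Y) Yss ×
                                            (∀ {xs} → Pointwise _∈_ xs Yss → P xs T))

    -- For each first entry `x`, the other entries are blown up by `g₁`. After an exchange, many `x`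
    -- share the same `Yss`, and `g₂` finds the replacement of `x` inside the set of these `x`. A
    -- second exchange moves it to the front. Blocks depending on `x` or on `Yss` are made constant
    -- by pigeonholing.
    substitution-step : ∀ {q B₁ B₂ w K K₁ K₂ K₃ K₄ K₅ K₆ K′} →
      SubstitutesAt q B₁ w K K₁ → 2 ^ w * K ≤ K₂ → K₁ ≤ K₂ →
      SwapsAt many (iter (tuples M) q) K₂ K₃ →
      FindsAt b M Ψ B₂ w K₃ K₄ → 2 ^ w * K₃ ≤ K₅ → K₄ ≤ K₅ →
      SwapsAt (iter (tuples M) q) (tuples M) K₅ K₆ →
      K₁ ≤ K′ → K₄ ≤ K′ → K₆ ≤ K′ →
      SubstitutesAt (suc q) (B₁ * B₂) w K K′
    substitution-step {q} {B₁} {B₂} {w} {K} {K₁} {K₂} {K₃} {K₄} {K₅}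
      g₁ K≤K₂ K₁≤K₂ past g₂ K₃≤K₅ K₄≤K₅ back K₁≤K′ K₄≤K′ K₆≤K′ {n} 1≤n H {Q} good Ω lΩ sΩ gΩ {P} anti p =
      T₂ , ⊑-trans r₂ r₁ , mono (iter (tuples M) (suc q)) {P = Final T₂} K₆≤K′
        (back {P = λ Yss Y → Final T₂ (Y ∷ Yss)} (mono (iter (tuples M) q) (≤-trans (*-monoˡ-≤ K₃ (^-monoʳ-≤ 2 sT₁)) K₃≤K₅)
                (map (iter (tuples M) q) (λ Yss → mono (tuples M) K₄≤K₅) p₂)))
      where
      Spread : Blocks (Fin n) → Fin n → List (List (Fin n)) → Set
      Spread T x Yss = Q x × All (λ Y → All Q Y × Ψ H T Y) Yss ×
                       (∀ {xs} → Pointwise _∈_ xs Yss → P (x ∷ xs) T)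
      spread : ∀ x → Holds (tuples q) K (λ xs → All Q (x ∷ xs) × P (x ∷ xs) Ω) →
               Σ (Blocks (Fin n)) λ T → T ⊑[ B₁ ] Ω × Holds (iter (tuples M) q) K₁ (Spread T x)
      spread x px =
        let Qx = All.head (proj₁ (proj₂ (witness (tuples q) 1≤n px)))
            (T , r , h) = g₁ 1≤n H {Q} (λ x → good-anti K₁≤K′ ∘ good x) Ω lΩ sΩ
                             (All.map (All.map (good-anti K₁≤K′)) gΩ)
                             {λ xs T → P (x ∷ xs) T} anti
                             (map (tuples q) (λ { xs (_ ∷ qs , p) → qs , p }) px)
        in T , r , map (iter (tuples M) q) (λ Yss h → Qx , h) h
      pigeon₁ = pigeonhole-⊑ many 1≤n K Ω (many-map spread p)
      T₁ = proj₁ pigeon₁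
      r₁ = proj₁ (proj₂ pigeon₁)
      p₁ = proj₂ (proj₂ pigeon₁)
      sT₁ : size T₁ ≤ w
      sT₁ = ≤-trans (⊑-size r₁) sΩ
      swapped : Holds (iter (tuples M) q) K₃ (λ Yss → Many K₃ (λ x → Spread T₁ x Yss))
      swapped = past (many-mono (≤-trans (*-monoˡ-≤ K (^-monoʳ-≤ 2 sΩ)) K≤K₂)
                       (many-map (λ x → mono (iter (tuples M) q) K₁≤K₂) p₁))
      Final : Blocks (Fin n) → List (List (Fin n)) → Set
      Final T Yss = All (λ Y → All Q Y × Ψ H T Y) Yss × (∀ {xs} → Pointwise _∈_ xs Yss → P xs T)
      finish : ∀ Yss → Many K₃ (λ x → Spread T₁ x Yss) →
               Σ (Blocks (Fin n)) λ T → T ⊑[ B₂ ] T₁ × Holds (tuples M) K₄ (λ Y → Final T (Y ∷ Yss))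
      finish Yss m@(many-by A large sound) =
        let (x₀ , _ , old , _) = many-witness 1≤n m
            (T , r , h) = g₂ 1≤n H A large (λ x Ax → good-anti K₄≤K′ (good x (proj₁ (sound x Ax)))) T₁
                             (trans (⊑-length r₁) lΩ) sT₁
                             (⊑-All r₁ (All.map (All.map (good-anti K₄≤K′)) gΩ))
        in T , r , map (tuples M) (λ Y (AY , ΨY) →
             (All.map (λ Ax → proj₁ (sound _ Ax)) AY , ΨY) ∷ All.map (λ (q , ψ) → q , Ψ-anti r ψ) old ,
             λ { (x∈Y ∷ tr) → anti r (proj₂ (proj₂ (sound _ (All.lookup AY x∈Y))) tr) }) h
      pigeon₂ = pigeonhole-⊑ (iter (tuples M) q) 1≤n K₃ T₁ (map (iter (tuples M) q) finish swapped)
      T₂ = proj₁ pigeon₂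
      r₂ = proj₁ (proj₂ pigeon₂)
      p₂ = proj₂ (proj₂ pigeon₂)

    -- The constants are fixed in order of dependence: the search behind `K₄` takes place in a set
    -- whose density `K₃` is known only after the first exchange.
    substitution-suc : ∀ q → Finds b M Ψ → (Σ ℕ λ B → ∀ w K → Σ ℕ λ K′ → SubstitutesAt q B w K K′) →
                       Σ ℕ λ B → ∀ w K → Σ ℕ λ K′ → SubstitutesAt (suc q) B w K K′
    substitution-suc q (B₂ , f₂) (B₁ , f₁) = B₁ * B₂ , λ w K → step₁ w K (f₁ w K)
      where
      past : Swap many (iter (tuples M) q)
      past = swap-iterʳ (swap-iterʳ swap-many M) q
      back : Swap (iter (tuples M) q) (tuples M)
      back = swap-iterˡ (swap-iterʳ (swap-iterˡ swap-many M) M) q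
      step₂ : ∀ w K K₁ K₂ → SubstitutesAt q B₁ w K K₁ → 2 ^ w * K ≤ K₂ → K₁ ≤ K₂ →
              (Σ ℕ λ K₄ → FindsAt b M Ψ B₂ w (factor past K₂) K₄) →
              Σ ℕ λ K′ → SubstitutesAt (suc q) (B₁ * B₂) w K K′
      step₂ w K K₁ K₂ g₁ le le₁ (K₄ , g₂) =
        K₆ + (K₁ + K₄) , substitution-step {q} {B₁} {B₂} {w} {K} {K₁} {K₂} {K₃} {K₄} {K₅} {K₆} g₁ le le₁ (swap past K₂) g₂
          (m≤m+n _ K₄) (m≤n+m K₄ (2 ^ w * K₃)) (swap back K₅)
          (≤-trans (m≤m+n K₁ K₄) (m≤n+m _ K₆)) (≤-trans (m≤n+m K₄ K₁) (m≤n+m _ K₆)) (m≤m+n K₆ _)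
        where
        K₃ = factor past K₂
        K₅ = 2 ^ w * K₃ + K₄
        K₆ = factor back K₅
      step₁ : ∀ w K → (Σ ℕ λ K₁ → SubstitutesAt q B₁ w K K₁) → Σ ℕ λ K′ → SubstitutesAt (suc q) (B₁ * B₂) w K K′
      step₁ w K (K₁ , g₁) = step₂ w K K₁ (2 ^ w * K + K₁) g₁ (m≤m+n _ K₁) (m≤n+m K₁ _)
                            (f₂ w (factor past (2 ^ w * K + K₁)))

    substitution : Finds b M Ψ → ∀ q → Σ ℕ λ B → ∀ w K → Σ ℕ λ K′ → SubstitutesAt q B w K K′
    substitution _ zero = 1 , λ w K → K , λ 1≤n H good Ω lΩ sΩ gΩ anti p →
      Ω , ⊑-refl Ω , [] , λ { [] → proj₂ p }
    substitution F (suc q) = substitution-suc q F (substitution F q)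

  robust-anti : ∀ {n} {H : Hypergraph3 n} {k c B T T′ Y} → T′ ⊑[ B ] T → Robust H k c T Y → Robust H k c T′ Y
  robust-anti r ρ U U⊆Y big = has-anti r (ρ U U⊆Y big)

  -- The root of the tree: the `suc p` entries of a tuple containing a copy are blown up to robust
  -- sets of depth `D`, all of whose transversals contain copies.
  finds-robust-suc : ∀ {k b p D} → Finds b (suc p) (λ H → Has H k) →
    (Σ ℕ λ B → ∀ w K → Σ ℕ λ K′ →
      SubstitutesAt {b} {suc p ^ D} {λ H → Robust H k (p ^ D)} (λ r → robust-anti r) (suc p) B w K K′) →
    Finds b (suc p ^ suc D) (λ H → Robust H k (p ^ suc D))
  finds-robust-suc {k} {b} {p} {D} (B₁ , f₁) (B₂ , f₂) = B₁ * B₂ , λ w K → step₁ w K (f₁ w K)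
    where
    M c : ℕ
    M = suc p ^ D
    c = p ^ D
    Sub : ∀ (w K₁ K₂ : ℕ) → Set₁
    Sub = SubstitutesAt {b} {M} {λ H → Robust H k c} (λ r → robust-anti r) (suc p) B₂
    robust : ∀ {n} (H : Hypergraph3 n) T Yss → length Yss ≡ suc p → All (Robust H k c T) Yss →
             (∀ {xs} → Pointwise _∈_ xs Yss → Has H k T xs) → Robust H k (p * c) T (concat Yss)
    robust H T Yss l ρs tr U U⊆ big with robust-concat H k c T Yss ρs tr U⊆
    ... | inj₁ h = h
    ... | inj₂ (inj₁ (xs , xs⊆U , h , _)) = has-mono (All.lookup xs⊆U) h
    -- One child is missed, so the other `p` children bound the length of `U` by `p * c`.
    ... | inj₂ (inj₂ few) =
      contradiction (+-cancelʳ-≤ c _ _ (≤-trans few (≤-reflexive (trans (cong (_* c) l) (+-comm c (p * c)))))) (<⇒≱ big)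
    step₂ : ∀ w K K₁ K₂ → FindsAt b (suc p) (λ H → Has H k) B₁ w K K₁ → Sub w K₁ K₂ →
            FindsAt b (suc p * M) (λ H → Robust H k (p * c)) (B₁ * B₂) w K (K₁ + K₂)
    step₂ w K K₁ K₂ g₁ g₂ {n} 1≤n H N large good Ω lΩ sΩ gΩ =
      T₂ , ⊑-trans r₂ r₁ ,
      iter-concat many (suc p) M
        (map (iter (tuples M) (suc p)) {P = λ Yss → length Yss ≡ suc p × Spread Yss} leaves
          (iter-length (tuples M) (suc p) {P = Spread}
            (mono (iter (tuples M) (suc p)) {P = Spread} (m≤n+m K₂ K₁) (proj₂ (proj₂ found₂)))))
      where
      found₁ = g₁ 1≤n H N large (λ x → good-anti (m≤m+n K₁ K₂) ∘ good x) Ω lΩ sΩ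
                  (All.map (All.map (good-anti (m≤m+n K₁ K₂))) gΩ)
      T₁ = proj₁ found₁
      r₁ = proj₁ (proj₂ found₁)
      found₂ = g₂ 1≤n H {λ x → N x ≡ true} (λ x → good-anti (m≤n+m K₂ K₁) ∘ good x) T₁ (trans (⊑-length r₁) lΩ)
                  (≤-trans (⊑-size r₁) sΩ) (⊑-All r₁ (All.map (All.map (good-anti (m≤n+m K₂ K₁))) gΩ))
                  {λ xs T → Has H k T xs} has-anti (proj₂ (proj₂ found₁))
      T₂ = proj₁ found₂
      r₂ = proj₁ (proj₂ found₂)
      Spread : List (List (Fin n)) → Set
      Spread Yss = All (λ Y → All (λ x → N x ≡ true) Y × Robust H k c T₂ Y) Yss ×
                   (∀ {xs} → Pointwise _∈_ xs Yss → Has H k T₂ xs)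
      leaves : ∀ Yss → length Yss ≡ suc p × Spread Yss →
               All (λ x → N x ≡ true) (concat Yss) × Robust H k (p * c) T₂ (concat Yss)
      leaves Yss (l , a , tr) = All.concat⁺ (All.map proj₁ a) , robust H T₂ Yss l (All.map proj₂ a) tr
    step₁ : ∀ w K → (Σ ℕ λ K₁ → FindsAt b (suc p) (λ H → Has H k) B₁ w K K₁) →
            Σ ℕ λ K′ → FindsAt b (suc p * M) (λ H → Robust H k (p * c)) (B₁ * B₂) w K K′
    step₁ w K (K₁ , g₁) = K₁ + proj₁ (f₂ w K₁) , step₂ w K K₁ (proj₁ (f₂ w K₁)) g₁ (proj₂ (f₂ w K₁))

  -- Leaves of a (1 + p)-ary tree of depth D: any choice of one leaf below each child of a node contains a
  -- copy, so a set of leaves without copies misses a child at every node and has size at most p ^ D.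
  finds-robust : ∀ {k b p} → Finds b (suc p) (λ H → Has H k) →
                 ∀ D → Finds b (suc p ^ D) (λ H → Robust H k (p ^ D))
  finds-robust F zero = 1 , λ w K → K , λ 1≤n H N large good Ω lΩ sΩ gΩ →
    Ω , ⊑-refl Ω , many-by N large λ x Nx → Nx ∷ [] ,
      λ U U⊆ big → contradiction (≤-trans big (length-mono-≤ U⊆)) λ { (s≤s ()) }
  finds-robust {k} {b} {p} F (suc D) =
    finds-robust-suc {k} {b} {p} {D} F (substitution {b} {suc p ^ D} {λ H → Robust H k (p ^ D)}
                          (λ r → robust-anti r) (finds-robust F D) (suc p))

-- The doubling step

-- By Bernoulli, `(1 + 1 / p) ^ D` is at least `1 + D / p`, which exceeds `B` for `D = p * B`. For
-- `p = 0` one level suffices.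
power-gap : ∀ B p → Σ ℕ λ D → B * p ^ D < suc p ^ D
power-gap B zero      = 1 , ≤-trans (≤-reflexive (cong suc (*-zeroʳ B))) (≤-reflexive refl)
power-gap B p@(suc o) = p * B , *-cancelˡ-< p _ _ (begin-strict
  p * (B * p ^ D)     ≡⟨ e p B (p ^ D) ⟩
  p * B * p ^ D       <⟨ +-monoˡ-< (p * B * p ^ D) (*-mono-≤ (s≤s (z≤n {o})) (m^n>0 p D)) ⟩
  p * p ^ D + p * B * p ^ D ≡⟨ *-distribʳ-+ (p ^ D) p (p * B) ⟨
  (p + D) * p ^ D     ≤⟨ bernoulli D ⟩
  p * suc p ^ D       ∎)
  where
  open ≤-Reasoning
  D = p * B
  e : ∀ p B x → p * (B * x) ≡ p * B * x
  e = solve-∀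
  bernoulli : ∀ D → (p + D) * p ^ D ≤ p * suc p ^ D
  bernoulli zero    = ≤-reflexive (cong (_* 1) (+-identityʳ p))
  bernoulli (suc D) = begin
    (p + suc D) * (p * p ^ D)              ≡⟨ e₁ p D (p ^ D) ⟩
    p * ((p + D) * p ^ D) + p * p ^ D      ≤⟨ +-mono-≤ (*-monoʳ-≤ p (bernoulli D)) (*-monoʳ-≤ p (^-monoˡ-≤ D (n≤1+n p))) ⟩
    p * (p * suc p ^ D) + p * suc p ^ D    ≡⟨ e₂ p (suc p ^ D) ⟩
    p * (suc p * suc p ^ D)                ∎
    where
    e₁ : ∀ p D x → (p + suc D) * (p * x) ≡ p * ((p + D) * x) + p * x
    e₁ = solve-∀
    e₂ : ∀ p y → p * (p * y) + p * y ≡ p * (suc p * y)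
    e₂ = solve-∀

length-cartesianProduct : ∀ {A B : Set} (xs : List A) (ys : List B) →
                          length (cartesianProduct xs ys) ≡ length xs * length ys
length-cartesianProduct []       ys = refl
length-cartesianProduct (x ∷ xs) ys =
  trans (length-++ (List.map (x ,_) ys)) (cong₂ _+_ (length-map (x ,_) ys) (length-cartesianProduct xs ys))

AllPairs-map-∈ : ∀ {A : Set} {R S : A → A → Set} {Y xs : List A} → (∀ {x y} → x ∈ Y → y ∈ Y → R x y → S x y) →
                 All (_∈ Y) xs → AllPairs R xs → AllPairs S xs
AllPairs-map-∈ h []       []       = []
AllPairs-map-∈ h (m ∷ ms) (r ∷ rs) =
  All.zipWith (λ (m′ , q) → h m m′ q) (ms , r) ∷ AllPairs-map-∈ h ms rs

-- Encoded as a sublist of `cartesianProduct Y Y`, hence one of boundedly many colours for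
-- `pigeonhole-⊆`.
trace : ∀ {n} → Hypergraph3 n → List (Fin n) → Fin n → List (Fin n × Fin n)
trace H Y x = filter (λ (u , v) → edge H x u v Bool.≟ true) (cartesianProduct Y Y)

trace-edge : ∀ {n} (H : Hypergraph3 n) {Y x x′} → trace H Y x ≡ trace H Y x′ →
             ∀ {u v} → u ∈ Y → v ∈ Y → Edge H x u v → Edge H x′ u v
trace-edge H {Y} {x} {x′} eq {u} {v} u∈ v∈ e =
  proj₂ (∈-filter⁻ (λ (u , v) → edge H x′ u v Bool.≟ true) {v = u , v} {xs = cartesianProduct Y Y}
    (subst ((u , v) ∈_) eq (∈-filter⁺ (λ (u , v) → edge H x u v Bool.≟ true) (∈-cartesianProduct⁺ u∈ v∈) e)))

has-double : ∀ {n} (H : Hypergraph3 n) {k T S S′} (h : Has H k T S) (h′ : Has H k T S′) →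
  All (λ x → AllPairs (Edge H x) (Has.vertices h′)) (Has.vertices h) →
  All (λ x → AllPairs (Edge H x) (Has.vertices h)) (Has.vertices h′) →
  AllBlocks (λ ω → All (λ x → All (Edge H ω x) (Has.vertices h′)) (Has.vertices h)) T →
  Has H (suc k) T (S ++ S′)
has-double H {k} {S = S} (has Q l s c t) (has Q′ l′ s′ c′ t′) a a′ x =
  has (Q ++ Q′) (trans (length-++ Q) (cong₂ _+_ l (trans l′ (sym (+-identityʳ (2 ^ k))))))
    (All.++⁺ (All.map ∈-++⁺ˡ s) (All.map (∈-++⁺ʳ S) s′))
    (clique-++ H c c′ a a′)
    (combine t t′ x)
  where
  combine : ∀ {T} → AllBlocks (λ ω → AllPairs (Edge H ω) Q) T → AllBlocks (λ ω → AllPairs (Edge H ω) Q′) T →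
            AllBlocks (λ ω → All (λ x → All (Edge H ω x) Q′) Q) T → AllBlocks (λ ω → AllPairs (Edge H ω) (Q ++ Q′)) T
  combine []       []       []       = []
  combine (t ∷ ts) (u ∷ us) (x ∷ xs) =
    All.zipWith (λ (t , (u , x)) → AllPairs.++⁺ t u x) (t , All.zip (u , x)) ∷ combine ts us xs

module _ (R σ : ℕ) where

  PairsAt : ℕ → ℕ → Set
  PairsAt K K′ = ∀ {n} (H : Hypergraph3 n) (N : Fin n → Bool) → n ≤ K * card N →
    (Ω : Blocks (Fin n)) → length Ω ≤ R → AllBlocks (Good R σ H K) Ω →
    Many K′ (λ y → Many K′ (λ z → N y ≡ true × N z ≡ true ×
      Σ (Blocks (Fin n)) λ T → T ⊑[ 2 + σ ] Ω × AllBlocks (λ ω → Edge H ω y z) T))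

  module _ {n : ℕ} (H : Hypergraph3 n) (N : Fin n → Bool) where

    Pair : Blocks (Fin n) → Fin n → Fin n → Set
    Pair T y z = N y ≡ true × N z ≡ true × AllBlocks (λ ω → Edge H ω y z) T

    -- In `robust` the centre is a block of its own, so every large part of `Y` contains a copy with
    -- pairs in the link of `y`. The pairs in `leaves` supply the mixed pairs of the doubled copy.
    record Star (k c : ℕ) (T : Blocks (Fin n)) (Y : List (Fin n)) (y : Fin n) : Set where
      constructor star
      field
        centre : N y ≡ true
        leaves : All (Pair T y) Y
        robust : Robust H k c ((y ∷ []) ∷ T) Y

    record Found (k : ℕ) (T : Blocks (Fin n)) (Z : List (Fin n)) : Set where
      constructor found
      field
        within : All (λ x → N x ≡ true) Z
        copy   : Has H k T Z

    -- The shrunken blocks depend on `y` and `z` at first; one pigeonhole over `z` and another over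
    -- `y` make them constant.
    many-pairs : ∀ {w K K₁ K₂} → 1 ≤ n → PairsAt K K₁ → 2 ^ w * K₁ ≤ K₂ → n ≤ K * card N →
      ∀ Ω → length Ω ≤ R → size Ω ≤ w → AllBlocks (Good R σ H K) Ω →
      Σ (Blocks (Fin n)) λ T → T ⊑[ 2 + σ ] Ω × Many K₂ (λ y → Many K₂ (Pair T y))
    many-pairs {w} {K} {K₁} {K₂} 1≤n pairs K₁≤K₂ large Ω b≤R sΩ gΩ =
      let (T , r , p) = pigeonhole-⊑ many 1≤n K₁ Ω (many-map pair (pairs H N large Ω b≤R gΩ))
      in T , r , many-mono K≤ p
      where
      K≤ : 2 ^ size Ω * K₁ ≤ K₂
      K≤ = ≤-trans (*-monoˡ-≤ K₁ (^-monoʳ-≤ 2 sΩ)) K₁≤K₂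
      pair : ∀ y → Many K₁ (λ z → N y ≡ true × N z ≡ true ×
               Σ (Blocks (Fin n)) λ T → T ⊑[ 2 + σ ] Ω × AllBlocks (λ ω → Edge H ω y z) T) →
             Σ (Blocks (Fin n)) λ T → T ⊑[ 2 + σ ] Ω × Many K₂ (Pair T y)
      pair y p =
        let (T , r , p′) = pigeonhole-⊑ many 1≤n K₁ Ω {P = λ T → Pair T y}
                             (many-map (λ z (Ny , Nz , T , r , e) → T , r , Ny , Nz , e) p)
        in T , r , many-mono K≤ p′

    -- For each `y`, a robust tuple is found among its partners `z`, with `y` as an additional
    -- block. The exchange then makes many `y` share one tuple.
    many-stars : ∀ {k b M c B w K₂ K₃ K₄ K₅} → 1 ≤ n →
      FindsAt R σ (suc b) M (λ H → Robust H k c) B (1 + w) K₂ K₃ → 2 ^ w * K₂ ≤ K₄ → K₃ ≤ K₄ →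
      SwapsAt many (tuples M) K₄ K₅ →
      (∀ x → N x ≡ true → Good R σ H K₃ x) →
      ∀ Ω → length Ω ≡ b → size Ω ≤ w → AllBlocks (Good R σ H K₃) Ω →
      Many K₂ (λ y → Many K₂ (Pair Ω y)) →
      Σ (Blocks (Fin n)) λ T → T ⊑[ B ] Ω × Holds (tuples M) K₅ (λ Y → Many K₅ (Star k c T Y))
    many-stars {k} {b} {M} {c} {B} {w} {K₂} {K₃} {K₄} {K₅} 1≤n trees K₂≤K₄ K₃≤K₄ swaps good Ω lΩ sΩ gΩ pairs =
      let (T , r , p) = pigeonhole-⊑ many 1≤n K₂ Ω (many-map tree pairs)
      in T , r , swaps (many-mono (≤-trans (*-monoˡ-≤ K₂ (^-monoʳ-≤ 2 sΩ)) K₂≤K₄)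
                   (many-map (λ y → mono (tuples M) K₃≤K₄) p))
      where
      -- A positive proportion of a one-element block is the whole block.
      root : ∀ {y t T} → t ⊆ y ∷ [] × 1 ≤ B * length t → ∀ {S} → Has H k (t ∷ T) S → Has H k ((y ∷ []) ∷ T) S
      root ((_ ∷ʳ []) , 1≤)   = contradiction (≤-trans 1≤ (≤-reflexive (*-zeroʳ B))) λ ()
      root ((refl ∷ []) , 1≤) = id

      Forest : Fin n → Set
      Forest y = Σ (Blocks (Fin n)) λ T → T ⊑[ B ] Ω × Holds (tuples M) K₃ (λ Y → Star k c T Y y)

      tree : ∀ y → Many K₂ (Pair Ω y) → Forest y
      tree y m@(many-by A A-large sound) = grow
        (trees 1≤n H A A-large (λ x Ax → good x (proj₁ (proj₂ (sound x Ax))))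
          ((y ∷ []) ∷ Ω) (cong suc lΩ) (s≤s sΩ) ((good y Ny ∷ []) ∷ gΩ))
        where
        Ny : N y ≡ true
        Ny = proj₁ (proj₂ (many-witness 1≤n m))
        grow : (Σ (Blocks (Fin n)) λ T → T ⊑[ B ] ((y ∷ []) ∷ Ω) ×
                 Holds (tuples M) K₃ (λ Y → All (λ x → A x ≡ true) Y × Robust H k c T Y)) → Forest y
        grow (t ∷ T , rt ∷ r , p) = T , r , map (tuples M) leaf p
          where
          leaf : ∀ Y → All (λ x → A x ≡ true) Y × Robust H k c (t ∷ T) Y → Star k c T Y y
          leaf Y (AY , ρ) = star Ny (All.map (λ Ax → let (Ny , Nz , e) = sound _ Ax in Ny , Nz , ⊑-All r e) AY)
                                 λ U U⊆Y big → root rt (ρ U U⊆Y big)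

    -- One copy, `Q′`, lies in `Z`; the other, `Q`, lies in `U` by robustness at `y₀`. Vertices of
    -- `Q′` have the trace of `y₀`, so their links contain the pairs of `Q`. Vertices of `Q` belong
    -- to the block `U`, so their links contain the pairs of `Q′`. Mixed pairs lie in the links of
    -- `T` because the vertices of `Q′` are centres of stars on `Y`.
    merge : ∀ {k c B Ω T U Y Z y₀} → T ⊑[ B ] Ω → U ⊆ Y → c < length U → Star k c Ω Y y₀ →
            All (λ y → trace H Y y₀ ≡ trace H Y y × Star k c Ω Y y) Z → Has H k (U ∷ T) Z →
            Found (suc k) T (Y ++ Z)
    merge {k} {T = T} {U} {Y} {Z} {y₀} r U⊆Y big (star _ zs ρ) stars (has Q′ l′ s′ c′ (t′ ∷ ts′)) =
      join (ρ U U⊆Y big)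
      where
      flip : ∀ {x} → x ∈ Z ++ Y → x ∈ Y ++ Z
      flip x∈ with ∈-++⁻ Z x∈
      ... | inj₁ x∈Z = ∈-++⁺ʳ Y x∈Z
      ... | inj₂ x∈Y = ∈-++⁺ˡ x∈Y
      join : Has H k ((y₀ ∷ []) ∷ _) U → Found (suc k) T (Y ++ Z)
      join (has Q l s cl ((e ∷ []) ∷ ts)) = found
        (All.++⁺ (All.map (λ (_ , Nz , _) → Nz) zs) (All.map (λ (_ , st) → Star.centre st) stars))
        (has-mono flip (has-double H (has Q′ l′ s′ c′ ts′) (has Q l Q⊆Y cl (⊑-All r ts))
          (All.map (λ x∈ → AllPairs-map-∈ (trace-edge H (proj₁ (All.lookup stars x∈))) Q⊆Y e) s′)
          (All.map (All.lookup t′) s)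
          (All.tabulate λ t∈ → All.tabulate λ ω∈ → All.tabulate λ x∈ → All.tabulate λ q∈ →
            let (_ , st) = All.lookup stars (All.lookup s′ x∈)
                (_ , _ , links) = All.lookup (Star.leaves st) (All.lookup Q⊆Y q∈)
            in All.lookup (All.lookup (⊑-All r links) t∈) ω∈)))
        where
        Q⊆Y : All (_∈ Y) Q
        Q⊆Y = All.map (Sublist.lookup U⊆Y) s

    -- For fixed `Y`, the trace colours the centres with at most `2 ^ (M * M)` colours. A linear
    -- colour class is searched for a copy with `Y` as an additional block.
    many-found : ∀ {k b m M c B w K₅ K₆ K₇ K₈} → 1 ≤ n → 2 ^ (M * M) * K₅ ≤ K₆ → B * c < M →
      FindsAt R σ (suc b) m (λ H → Has H k) B (M + w) K₆ K₇ → 2 ^ w * K₅ ≤ K₈ → K₇ ≤ K₈ →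
      (∀ x → N x ≡ true → Good R σ H K₇ x) →
      ∀ Ω → length Ω ≡ b → size Ω ≤ w → AllBlocks (Good R σ H K₇) Ω →
      Holds (tuples M) K₅ (λ Y → Many K₅ (Star k c Ω Y)) →
      Σ (Blocks (Fin n)) λ T → T ⊑[ B ] Ω × Holds (tuples (M + m)) K₈ (Found (suc k) T)
    many-found {k} {b} {m} {M} {c} {B} {w} {K₅} {K₆} {K₇} {K₈}
      1≤n K₅≤K₆ gap copies K₅≤K₈ K₇≤K₈ good Ω lΩ sΩ gΩ stars =
      let (T , r , p) = pigeonhole-⊑ (tuples M) 1≤n K₅ Ω (map (tuples M) finish (iter-length many M stars))
      in T , r , iter-++ many M m (mono (tuples M) (≤-trans (*-monoˡ-≤ K₅ (^-monoʳ-≤ 2 sΩ)) K₅≤K₈)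
                   (map (tuples M) (λ Y → mono (tuples m) K₇≤K₈) p))
      where
      Extends : List (Fin n) → Set
      Extends Y = Σ (Blocks (Fin n)) λ T → T ⊑[ B ] Ω × Holds (tuples m) K₇ (λ Z → Found (suc k) T (Y ++ Z))

      finish : ∀ Y → length Y ≡ M × Many K₅ (Star k c Ω Y) → Extends Y
      finish Y (lY , stars) =
        let (t , _ , p) = pigeonhole-⊆ many K₅ (cartesianProduct Y Y) {Class}
              (many-map (λ y s → trace H Y y ,
                filter-⊆ (λ (u , v) → edge H y u v Bool.≟ true) (cartesianProduct Y Y) , refl , s) stars)
        in conclude t (many-mono K≤ p)
        where
        Class : List (Fin n × Fin n) → Fin n → Set
        Class t y = t ≡ trace H Y y × Star k c Ω Y y
        K≤ : 2 ^ length (cartesianProduct Y Y) * K₅ ≤ K₆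
        K≤ = ≤-trans (≤-reflexive (cong (λ l → 2 ^ l * K₅)
               (trans (length-cartesianProduct Y Y) (cong₂ _*_ lY lY)))) K₅≤K₆
        conclude : ∀ t → Many K₆ (Class t) → Extends Y
        conclude t class@(many-by A A-large sound) = extend (proj₂ (many-witness 1≤n class))
          (copies 1≤n H A A-large (λ x Ax → good x (Star.centre (proj₂ (sound x Ax))))
            (Y ∷ Ω) (cong suc lΩ) (+-mono-≤ (≤-reflexive lY) sΩ)
            (All.map (λ (_ , Nz , _) → good _ Nz) (Star.leaves (proj₂ (proj₂ (many-witness 1≤n class)))) ∷ gΩ))
          where
          extend : ∀ {y₀} → Class t y₀ → (Σ (Blocks (Fin n)) λ T → T ⊑[ B ] (Y ∷ Ω) ×
                     Holds (tuples m) K₇ (λ Z → All (λ x → A x ≡ true) Z × Has H k T Z)) → Extends Y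
          extend (t≡ , star₀) (U ∷ T , (U⊆Y , dense) ∷ r , p) = T , r , map (tuples m) (λ Z (AZ , h) →
            -- `B * c < M` and `M ≤ B * length U` give `c < length U`, as robustness demands.
            merge r U⊆Y (*-cancelˡ-< B c (length U) (≤-trans gap (≤-trans (≤-reflexive (sym lY)) dense))) star₀
              (All.map (λ Ay → trans (sym t≡) (proj₁ (sound _ Ay)) , proj₂ (sound _ Ay)) AZ) h) p

  doubling-step : ∀ {k b m M c BT BC w K K₁ K₂ K₃ K₄ K₅ K₆ K₇ K₈ K′} → b ≤ R →
    PairsAt K K₁ → 2 ^ w * K₁ ≤ K₂ →
    FindsAt R σ (suc b) M (λ H → Robust H k c) BT (1 + w) K₂ K₃ → 2 ^ w * K₂ ≤ K₄ → K₃ ≤ K₄ →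
    SwapsAt many (tuples M) K₄ K₅ → 2 ^ (M * M) * K₅ ≤ K₆ → BC * c < M →
    FindsAt R σ (suc b) m (λ H → Has H k) BC (M + w) K₆ K₇ → 2 ^ w * K₅ ≤ K₈ → K₇ ≤ K₈ →
    K ≤ K′ → K₃ ≤ K′ → K₇ ≤ K′ → K₈ ≤ K′ →
    FindsAt R σ b (M + m) (λ H → Has H (suc k)) ((2 + σ) * BT * BC) w K K′
  doubling-step {k} {b} {m} {M} {c} {BT} {BC} {w} {K} {K₁} {K₂} {K₃} {K₄} {K₅} {K₆} {K₇} {K₈} {K′}
    b≤R pairs K₁≤K₂ trees K₂≤K₄ K₃≤K₄ swaps K₅≤K₆ gap copies K₅≤K₈ K₇≤K₈
    K≤K′ K₃≤K′ K₇≤K′ K₈≤K′ {n} 1≤n H N large good Ω lΩ sΩ gΩ =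
    with-pairs (many-pairs H N {w} {K} {K₁} {K₂} 1≤n pairs K₁≤K₂ large Ω (≤-trans (≤-reflexive lΩ) b≤R) sΩ
                 (All.map (All.map (good-anti K≤K′)) gΩ))
    where
    Result : Set
    Result = Σ (Blocks (Fin n)) λ T → T ⊑[ (2 + σ) * BT * BC ] Ω ×
             Holds (tuples (M + m)) K′ (λ Z → All (λ x → N x ≡ true) Z × Has H (suc k) T Z)
    with-stars : ∀ {B T₀} → T₀ ⊑[ B ] Ω → B * BC ≡ (2 + σ) * BT * BC →
                 Holds (tuples M) K₅ (λ Y → Many K₅ (Star H N k c T₀ Y)) → Result
    with-stars {T₀ = T₀} r₀ e p₀ =
      let (T₁ , r₁ , p₁) = many-found H N {k} {b} {m} {M} {c} {BC} {w} {K₅} {K₆} {K₇} {K₈} 1≤n K₅≤K₆ gap copies K₅≤K₈ K₇≤K₈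
                             (λ x → good-anti K₇≤K′ ∘ good x) T₀ (trans (⊑-length r₀) lΩ) (≤-trans (⊑-size r₀) sΩ)
                             (All.map (All.map (good-anti K₇≤K′)) (⊑-All r₀ gΩ)) p₀
      in T₁ , subst (T₁ ⊑[_] Ω) e (⊑-trans r₁ r₀) ,
         mono (tuples (M + m)) K₈≤K′ (map (tuples (M + m)) (λ Z f → Found.within f , Found.copy f) p₁)
    with-pairs : (Σ (Blocks (Fin n)) λ T → T ⊑[ 2 + σ ] Ω × Many K₂ (λ y → Many K₂ (Pair H N T y))) → Result
    with-pairs (T₀ , r₀ , p₀) =
      let (T₁ , r₁ , p₁) = many-stars H N {k} {b} {M} {c} {BT} {w} {K₂} {K₃} {K₄} {K₅} 1≤n trees K₂≤K₄ K₃≤K₄ swaps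
                             (λ x → good-anti K₃≤K′ ∘ good x) T₀ (trans (⊑-length r₀) lΩ) (≤-trans (⊑-size r₀) sΩ)
                             (All.map (All.map (good-anti K₃≤K′)) (⊑-All r₀ gΩ)) p₀
      in with-stars (⊑-trans r₁ r₀) refl p₁

  -- `copies` serves twice: to grow trees, and then with the `M` leaves of a tree as a block. The
  -- depth `D` is chosen from its proportion `BC`, so that the surviving leaves outnumber `c`.
  doubling : ∀ {k b p} → b ≤ R → (∀ K → Σ ℕ (PairsAt K)) → Finds R σ (suc b) (suc p) (λ H → Has H k) →
             Σ ℕ λ p′ → Finds R σ b (suc p′) (λ H → Has H (suc k))
  doubling {k} {b} {p} b≤R pairs copies@(BC , fC) = M + p , subst (λ m → Finds R σ b m (λ H → Has H (suc k))) (+-suc M p)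
                    ((2 + σ) * BT * BC , λ w K → step₁ w K (pairs K))
    where
    D M c BT : ℕ
    D = proj₁ (power-gap BC p)
    M = suc p ^ D
    c = p ^ D
    gap : BC * c < M
    gap = proj₂ (power-gap BC p)
    robust : Finds R σ (suc b) M (λ H → Robust H k c)
    robust = finds-robust R σ copies D
    BT = proj₁ robust
    past : Swap many (tuples M)
    past = swap-iterʳ swap-many M
    Result : ℕ → ℕ → Set
    Result w K = Σ ℕ λ K′ → FindsAt R σ b (M + suc p) (λ H → Has H (suc k)) ((2 + σ) * BT * BC) w K K′
    step₃ : ∀ w K {K₁ K₂ K₃ K₄ K₅ K₆} → PairsAt K K₁ → 2 ^ w * K₁ ≤ K₂ →
            FindsAt R σ (suc b) M (λ H → Robust H k c) BT (1 + w) K₂ K₃ → 2 ^ w * K₂ ≤ K₄ → K₃ ≤ K₄ →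
            SwapsAt many (tuples M) K₄ K₅ → 2 ^ (M * M) * K₅ ≤ K₆ →
            (Σ ℕ λ K₇ → FindsAt R σ (suc b) (suc p) (λ H → Has H k) BC (M + w) K₆ K₇) → Result w K
    step₃ w K {K₁} {K₂} {K₃} {K₄} {K₅} {K₆} pairs K₁≤K₂ trees K₂≤K₄ K₃≤K₄ swaps K₅≤K₆ (K₇ , copies) =
      K₈ + (K + K₃) , doubling-step {k} {b} {suc p} {M} {c} {BT} {BC} {w} {K} {K₁} {K₂} {K₃} {K₄} {K₅} {K₆} {K₇} {K₈}
                         b≤R pairs K₁≤K₂ trees K₂≤K₄ K₃≤K₄ swaps K₅≤K₆ gap copies
        (m≤m+n _ K₇) (m≤n+m K₇ (2 ^ w * K₅))
        (≤-trans (m≤m+n K K₃) (m≤n+m _ K₈)) (≤-trans (m≤n+m K₃ K) (m≤n+m _ K₈))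
        (≤-trans (m≤n+m K₇ (2 ^ w * K₅)) (m≤m+n K₈ _)) (m≤m+n K₈ _)
      where K₈ = 2 ^ w * K₅ + K₇
    step₂ : ∀ w K {K₁ K₂} → PairsAt K K₁ → 2 ^ w * K₁ ≤ K₂ →
            (Σ ℕ λ K₃ → FindsAt R σ (suc b) M (λ H → Robust H k c) BT (1 + w) K₂ K₃) → Result w K
    step₂ w K {K₂ = K₂} pairs K₁≤K₂ (K₃ , trees) =
      step₃ w K pairs K₁≤K₂ trees (m≤m+n _ K₃) (m≤n+m K₃ (2 ^ w * K₂)) (swap past (2 ^ w * K₂ + K₃)) ≤-refl
        (fC (M + w) (2 ^ (M * M) * factor past (2 ^ w * K₂ + K₃)))
    step₁ : ∀ w K → Σ ℕ (PairsAt K) → Result w K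
    step₁ w K (K₁ , pairs) = step₂ w K pairs ≤-refl (proj₂ robust (1 + w) (2 ^ w * K₁))

-- Pairs in the links of many vertices

∑² : ∀ {n} → (Fin n → Fin n → ℕ) → ℕ
∑² {n} f = ΣFin n λ y → ΣFin n λ z → f y z

∑²-mono-≤ : ∀ {n} {f g : Fin n → Fin n → ℕ} → (∀ y z → f y z ≤ g y z) → ∑² f ≤ ∑² g
∑²-mono-≤ {n} h = ∑-mono-≤ (allFin n) λ y → ∑-mono-≤ (allFin n) (h y)

∑²-+ : ∀ {n} (f g : Fin n → Fin n → ℕ) → ∑² (λ y z → f y z + g y z) ≡ ∑² f + ∑² g
∑²-+ {n} f g = trans (∑-cong (allFin n) λ y → ∑-+ (f y) (g y) (allFin n)) (∑-+ _ _ (allFin n))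

∑²-* : ∀ {n} c (f : Fin n → Fin n → ℕ) → ∑² (λ y z → c * f y z) ≡ c * ∑² f
∑²-* {n} c f = trans (∑-cong (allFin n) λ y → ∑-* c (f y) (allFin n)) (∑-* c _ (allFin n))

∑²-∑ : ∀ {n} {A : Set} (g : A → Fin n → Fin n → ℕ) o → ∑² (λ y z → ∑ o λ a → g a y z) ≡ ∑ o λ a → ∑² (g a)
∑²-∑ {n} g o = trans (∑-cong (allFin n) λ y → ∑-swap (λ z a → g a y z) (allFin n) o)
                     (∑-swap (λ y a → ΣFin n (g a y)) (allFin n) o)

square : ∀ {n} → (Fin n → Bool) → Fin n → Fin n → ℕ
square A y z = 𝟙 (A y) * 𝟙 (A z)

∑²-square : ∀ {n} (A : Fin n → Bool) → ∑² (square A) ≡ card A * card A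
∑²-square {n} A = trans (∑-cong (allFin n) λ y → trans (∑-* (𝟙 (A y)) _ (allFin n)) (*-comm (𝟙 (A y)) (card A)))
                        (∑-* (card A) _ (allFin n))

module _ {n : ℕ} (R σ : ℕ) (H : Hypergraph3 n) where

  through : Fin n → Fin n → List (Fin n) → List (Fin n)
  through y z = filter (λ ω → edge H ω y z Bool.≟ true)

  avoiding : List (Fin n) → Fin n → Fin n → ℕ
  avoiding o y z = ∑ o λ ω → 𝟙 (not (edge H ω y z))

  sparse : List (Fin n) → Fin n → Fin n → Bool
  sparse o y z = (2 + σ) * length (through y z o) <ᵇ length o

  through+avoiding : ∀ o y z → length (through y z o) + avoiding o y z ≡ length o
  through+avoiding []      y z = refl
  through+avoiding (ω ∷ o) y z with edge H ω y z
  ... | true  = cong suc (through+avoiding o y z)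
  ... | false = trans (+-suc _ _) (cong suc (through+avoiding o y z))

  sparse-avoiding : ∀ o y z → (1 + σ) * length o * 𝟙 (sparse o y z) ≤ (2 + σ) * avoiding o y z
  sparse-avoiding o y z with sparse o y z in eq
  ... | false = ≤-trans (≤-reflexive (*-zeroʳ ((1 + σ) * length o))) z≤n
  ... | true  = +-cancelˡ-≤ (length o) _ _ (begin
    length o + (1 + σ) * length o * 1                                       ≡⟨ cong (length o +_) (*-identityʳ _) ⟩
    (2 + σ) * length o                                                      ≡⟨ cong ((2 + σ) *_) (through+avoiding o y z) ⟨
    (2 + σ) * (length (through y z o) + avoiding o y z)                     ≡⟨ *-distribˡ-+ (2 + σ) (length (through y z o)) _ ⟩
    (2 + σ) * length (through y z o) + (2 + σ) * avoiding o y z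
      ≤⟨ +-monoˡ-≤ _ (<⇒≤ (<ᵇ⇒< ((2 + σ) * length (through y z o)) (length o) (subst T (sym eq) tt))) ⟩
    length o + (2 + σ) * avoiding o y z                                     ∎)
    where open ≤-Reasoning

  module _ (A : Fin n → Bool) where

    dense-pair : Blocks (Fin n) → Fin n → Fin n → Bool
    dense-pair Ω y z = A y ∧ (A z ∧ all (λ o → not (sparse o y z)) Ω)

    covered : ∀ Ω y z → square A y z ≤ 𝟙 (dense-pair Ω y z) + ∑ Ω (λ o → square A y z * 𝟙 (sparse o y z))
    covered Ω y z with A y | A z
    ... | false | _     = z≤n
    ... | true  | false = z≤n
    ... | true  | true  = go Ω
      where
      go : ∀ Ω → 1 ≤ 𝟙 (all (λ o → not (sparse o y z)) Ω) + ∑ Ω (λ o → 1 * 𝟙 (sparse o y z))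
      go []      = ≤-refl
      go (o ∷ Ω) with sparse o y z
      ... | true  = s≤s z≤n
      ... | false = go Ω

    dense-pair-sound : ∀ Ω y z → dense-pair Ω y z ≡ true → A y ≡ true × A z ≡ true ×
      Σ (Blocks (Fin n)) λ T → T ⊑[ 2 + σ ] Ω × AllBlocks (λ ω → Edge H ω y z) T
    dense-pair-sound Ω y z eq =
      Bool.∧-conicalˡ (A y) _ eq , Bool.∧-conicalˡ (A z) _ eq′ , go Ω (Bool.∧-conicalʳ (A z) _ eq′)
      where
      eq′ : A z ∧ all (λ o → not (sparse o y z)) Ω ≡ true
      eq′ = Bool.∧-conicalʳ (A y) _ eq
      go : ∀ Ω → all (λ o → not (sparse o y z)) Ω ≡ true →
           Σ (Blocks (Fin n)) λ T → T ⊑[ 2 + σ ] Ω × AllBlocks (λ ω → Edge H ω y z) T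
      go []      _  = [] , [] , []
      go (o ∷ Ω) eq =
        let e = Bool.∧-conicalˡ (not (sparse o y z)) _ eq
            (T , r , l) = go Ω (Bool.∧-conicalʳ (not (sparse o y z)) _ eq)
        in through y z o ∷ T , (filter-⊆ (λ ω → edge H ω y z Bool.≟ true) o , ≮⇒≥ (λ lt → dense e (<⇒<ᵇ lt))) ∷ r ,
           All.all-filter (λ ω → edge H ω y z Bool.≟ true) o ∷ l
        where
        dense : ∀ {b} → not b ≡ true → T b → ⊥
        dense {false} _ ()

    sparse-pairs : List (Fin n) → ℕ
    sparse-pairs o = ∑² λ y z → square A y z * 𝟙 (sparse o y z)

  module _ (1≤R : 1 ≤ R) (A : Fin n → Bool) (K : ℕ) (large : n ≤ K * card A) where

    -- Double counting of the triples `ω`, `y`, `z` whose pair `y z` is missing from the link of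
    -- `ω`: a sparse pair is missing from at least the share `(1 + σ) / (2 + σ)` of the links, and
    -- goodness bounds the missing pairs for each `ω`.
    few-sparse : ∀ o → All (Good R σ H K) o → R * ((1 + σ) * sparse-pairs A o) ≤ σ * (card A * card A)
    -- The main case cancels `length o`; an empty block has no sparse pairs because `sparse` is a
    -- strict inequality.
    few-sparse [] _ = ≤-trans (≤-reflexive none) z≤n
      where
      none : R * ((1 + σ) * sparse-pairs A []) ≡ 0
      none = trans (cong (λ x → R * ((1 + σ) * x))
               (trans (∑-cong (allFin n) λ y → trans (∑-cong (allFin n) λ z →
                  trans (cong (λ l → square A y z * 𝟙 (l <ᵇ 0)) (*-zeroʳ (2 + σ))) (*-zeroʳ (square A y z)))
                  (trans (ΣFin-const n 0) (*-zeroʳ n)))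
                (trans (ΣFin-const n 0) (*-zeroʳ n))))
               (trans (cong (R *_) (*-zeroʳ (1 + σ))) (*-zeroʳ R))
    few-sparse o@(_ ∷ _) good = *-cancelˡ-≤ (length o) (begin
      length o * (R * ((1 + σ) * sparse-pairs A o))                 ≡⟨ e (length o) R (1 + σ) (sparse-pairs A o) ⟩
      R * ((1 + σ) * length o * sparse-pairs A o)                   ≡⟨ cong (R *_) (∑²-* {n} ((1 + σ) * length o) _) ⟨
      R * ∑² (λ y z → (1 + σ) * length o * (square A y z * 𝟙 (sparse o y z)))
        ≤⟨ *-monoʳ-≤ R (∑²-mono-≤ pointwise) ⟩
      R * ∑² (λ y z → (2 + σ) * ∑ o (λ ω → square A y z * 𝟙 (not (edge H ω y z))))
        ≡⟨ cong (R *_) (∑²-* {n} (2 + σ) _) ⟩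
      R * ((2 + σ) * ∑² (λ y z → ∑ o (λ ω → square A y z * 𝟙 (not (edge H ω y z)))))
        ≡⟨ cong (λ x → R * ((2 + σ) * x)) (∑²-∑ {n} (λ ω y z → square A y z * 𝟙 (not (edge H ω y z))) o) ⟩
      R * ((2 + σ) * ∑ o (λ ω → missing H ω A))                   ≡⟨ *-assoc R (2 + σ) _ ⟨
      R * (2 + σ) * ∑ o (λ ω → missing H ω A)                     ≡⟨ ∑-* (R * (2 + σ)) _ o ⟨
      ∑ o (λ ω → R * (2 + σ) * missing H ω A)                     ≤⟨ links o good ⟩
      length o * (σ * (card A * card A))                          ∎)
      where
      open ≤-Reasoning
      e : ∀ l R s p → l * (R * (s * p)) ≡ R * (s * l * p)
      e = solve-∀
      links : ∀ o → All (Good R σ H K) o →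
              ∑ o (λ ω → R * (2 + σ) * missing H ω A) ≤ length o * (σ * (card A * card A))
      links []      []       = z≤n
      links (ω ∷ o) (g ∷ gs) = +-mono-≤ (Good.dense-link g A large) (links o gs)
      pointwise : ∀ y z → (1 + σ) * length o * (square A y z * 𝟙 (sparse o y z)) ≤
                          (2 + σ) * ∑ o (λ ω → square A y z * 𝟙 (not (edge H ω y z)))
      pointwise y z = begin
        (1 + σ) * length o * (square A y z * 𝟙 (sparse o y z))
          ≡⟨ e₁ ((1 + σ) * length o) (square A y z) _ ⟩
        square A y z * ((1 + σ) * length o * 𝟙 (sparse o y z))    ≤⟨ *-monoʳ-≤ (square A y z) (sparse-avoiding o y z) ⟩
        square A y z * ((2 + σ) * avoiding o y z)                 ≡⟨ e₁ (square A y z) (2 + σ) _ ⟩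
        (2 + σ) * (square A y z * avoiding o y z)                 ≡⟨ cong ((2 + σ) *_) (∑-* (square A y z) _ o) ⟨
        (2 + σ) * ∑ o (λ ω → square A y z * 𝟙 (not (edge H ω y z))) ∎
        where
        e₁ : ∀ a b c → a * (b * c) ≡ b * (a * c)
        e₁ = solve-∀

    -- One block spoils at most the share `σ / (R * (1 + σ))` of the pairs in `A`, so `R` blocks
    -- still leave the share `1 / (1 + σ)`. This is what limits the number of blocks.
    few-sparse-blocks : ∀ Ω → length Ω ≤ R → AllBlocks (Good R σ H K) Ω →
                        (1 + σ) * ∑ Ω (sparse-pairs A) ≤ σ * (card A * card A)
    few-sparse-blocks Ω b≤R good = *-cancelˡ-≤ R {{>-nonZero 1≤R}} (begin
      R * ((1 + σ) * ∑ Ω (sparse-pairs A))          ≡⟨ *-assoc R (1 + σ) _ ⟨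
      R * (1 + σ) * ∑ Ω (sparse-pairs A)            ≡⟨ ∑-* (R * (1 + σ)) (sparse-pairs A) Ω ⟨
      ∑ Ω (λ o → R * (1 + σ) * sparse-pairs A o)  ≤⟨ go Ω good ⟩
      length Ω * (σ * (card A * card A))        ≤⟨ *-monoˡ-≤ (σ * (card A * card A)) b≤R ⟩
      R * (σ * (card A * card A))               ∎)
      where
      open ≤-Reasoning
      go : ∀ Ω → AllBlocks (Good R σ H K) Ω →
           ∑ Ω (λ o → R * (1 + σ) * sparse-pairs A o) ≤ length Ω * (σ * (card A * card A))
      go []      []       = z≤n
      go (o ∷ Ω) (g ∷ gs) = +-mono-≤ (≤-trans (≤-reflexive (*-assoc R (1 + σ) _)) (few-sparse o g)) (go Ω gs)

    dense-pairs : ∀ Ω → length Ω ≤ R → AllBlocks (Good R σ H K) Ω →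
                  card A * card A ≤ (1 + σ) * ∑² (λ y z → 𝟙 (dense-pair A Ω y z))
    dense-pairs Ω b≤R good = +-cancelʳ-≤ (σ * a²) _ _ (begin
      a² + σ * a²                                        ≡⟨⟩
      (1 + σ) * a²                                       ≡⟨ cong ((1 + σ) *_) (∑²-square A) ⟨
      (1 + σ) * ∑² (square A)                            ≤⟨ *-monoʳ-≤ (1 + σ) (∑²-mono-≤ (covered A Ω)) ⟩
      (1 + σ) * ∑² (λ y z → 𝟙 (dense-pair A Ω y z) + ∑ Ω (λ o → square A y z * 𝟙 (sparse o y z)))
        ≡⟨ cong ((1 + σ) *_) (trans (∑²-+ {n} _ _) (cong (G +_) (∑²-∑ {n} (λ o y z → square A y z * 𝟙 (sparse o y z)) Ω))) ⟩
      (1 + σ) * (G + ∑ Ω (sparse-pairs A))                   ≡⟨ *-distribˡ-+ (1 + σ) G _ ⟩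
      (1 + σ) * G + (1 + σ) * ∑ Ω (sparse-pairs A)           ≤⟨ +-monoʳ-≤ ((1 + σ) * G) (few-sparse-blocks Ω b≤R good) ⟩
      (1 + σ) * G + σ * a²                               ∎)
      where
      open ≤-Reasoning
      a² = card A * card A
      G = ∑² (λ y z → 𝟙 (dense-pair A Ω y z))

pairs-at : ∀ {R} σ → 1 ≤ R → ∀ K → Σ ℕ (PairsAt R σ K)
pairs-at {R} σ 1≤R K = 2 * ((1 + σ) * (K * K)) , λ {n} H N large Ω b≤R good →
  many-map (λ y y-large → many-by (dense-pair R σ H N Ω y) y-large (dense-pair-sound R σ H N Ω y))
    (many-rows ((1 + σ) * (K * K)) (dense-pair R σ H N Ω) (begin
      n * n                                       ≤⟨ *-mono-≤ large large ⟩
      K * card N * (K * card N)                   ≡⟨ e₁ K (card N) ⟩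
      K * K * (card N * card N)                   ≤⟨ *-monoʳ-≤ (K * K) (dense-pairs R σ H 1≤R N K large Ω b≤R good) ⟩
      K * K * ((1 + σ) * _)                       ≡⟨ e₂ (K * K) (1 + σ) _ ⟩
      (1 + σ) * (K * K) * _                       ∎))
  where
  open ≤-Reasoning
  e₁ : ∀ K a → K * a * (K * a) ≡ K * K * (a * a)
  e₁ = solve-∀
  e₂ : ∀ a b c → a * (b * c) ≡ b * a * c
  e₂ = solve-∀

-- Each doubling uses copies of half the size with one more block, which preserves `b + k ≤ suc R`
-- and keeps `b ≤ R` in the step, as `PairsAt` demands. For `k = 0` a single vertex has no pairs,
-- and the blocks stay whole.
copies : ∀ {R} σ → 1 ≤ R → ∀ k b → b + k ≤ suc R → Σ ℕ λ p → Finds R σ b (suc p) (λ H → Has H k)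
copies σ 1≤R zero    b le = 0 , 1 , λ w K → K , λ 1≤n H N large good Ω lΩ sΩ gΩ →
  Ω , ⊑-refl Ω , many-by N large λ x Nx → Nx ∷ [] ,
    has (x ∷ []) refl (here refl ∷ []) ([] , tt) (All.universal (λ o → All.universal (λ ω → [] ∷ []) o) Ω)
copies σ 1≤R (suc k) b le =
  doubling _ σ {p = proj₁ (copies σ 1≤R k (suc b) (≤-trans (≤-reflexive (sym (+-suc b k))) le))}
    (s≤s⁻¹ (≤-trans (s≤s (m≤m+n b k)) (≤-trans (≤-reflexive (sym (+-suc b k))) le)))
    (pairs-at σ 1≤R) (proj₂ (copies σ 1≤R k (suc b) (≤-trans (≤-reflexive (sym (+-suc b k))) le)))

AllPairs-lookup : ∀ {A : Set} {S : A → A → Set} → (∀ {x y} → S x y → S y x) → ∀ {xs} → AllPairs S xs →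
                  ∀ i j → i ≢ j → S (List.lookup xs i) (List.lookup xs j)
AllPairs-lookup s (p ∷ ps) zero    zero    i≢j = contradiction refl i≢j
AllPairs-lookup s (p ∷ ps) zero    (suc j) i≢j = All.lookup p (∈-lookup j)
AllPairs-lookup s (p ∷ ps) (suc i) zero    i≢j = s (All.lookup p (∈-lookup i))
AllPairs-lookup s (p ∷ ps) (suc i) (suc j) i≢j = AllPairs-lookup s ps i j (i≢j ∘ cong suc)

-- Most vertices are good

toℚᵘ-/ : ∀ i d → toℚᵘ (i ℚ./ suc d) ≃ mkℚᵘ i d
toℚᵘ-/ i d = ℚ.toℚᵘ-fromℚᵘ (mkℚᵘ i d)

unnormalise : ∀ a r m f d W X ε → toℚᵘ ε ≡ mkℚᵘ (pos m) f →
  toℚᵘ (((pos a) ℚ./ suc r ℚ.+ ε) ℚ.* toℚ W ℚ.- (pos 1) ℚ./ suc d ℚ.* toℚ X) ≃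
  (mkℚᵘ (pos a) r ℚᵘ.+ mkℚᵘ (pos m) f) ℚᵘ.* mkℚᵘ (pos W) 0 ℚᵘ.- mkℚᵘ (pos 1) d ℚᵘ.* mkℚᵘ (pos X) 0
unnormalise a r m f d W X ε ε≡ = begin
  toℚᵘ ((p ℚ.+ ε) ℚ.* toℚ W ℚ.- η ℚ.* toℚ X)
    ≈⟨ ℚ.toℚᵘ-homo-+ ((p ℚ.+ ε) ℚ.* toℚ W) (ℚ.- (η ℚ.* toℚ X)) ⟩
  toℚᵘ ((p ℚ.+ ε) ℚ.* toℚ W) ℚᵘ.+ toℚᵘ (ℚ.- (η ℚ.* toℚ X))
    ≈⟨ ℚᵘ.+-cong (ℚ.toℚᵘ-homo-* (p ℚ.+ ε) (toℚ W)) (ℚ.toℚᵘ-homo‿- (η ℚ.* toℚ X)) ⟩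
  toℚᵘ (p ℚ.+ ε) ℚᵘ.* toℚᵘ (toℚ W) ℚᵘ.- toℚᵘ (η ℚ.* toℚ X)
    ≈⟨ ℚᵘ.+-cong
         (ℚᵘ.*-cong (ℚᵘ.≃-trans (ℚ.toℚᵘ-homo-+ p ε) (ℚᵘ.+-cong (toℚᵘ-/ (pos a) r) (ℚᵘ.≃-reflexive ε≡))) (toℚᵘ-/ (pos W) 0))
         (ℚᵘ.-‿cong (ℚᵘ.≃-trans (ℚ.toℚᵘ-homo-* η (toℚ X)) (ℚᵘ.*-cong (toℚᵘ-/ (pos 1) d) (toℚᵘ-/ (pos X) 0)))) ⟩
  _ ∎
  where
  open ℚᵘ.≃-Reasoning
  p = (pos a) ℚ./ suc r
  η = (pos 1) ℚ./ suc d

-- Multiplication by `suc r * suc f * suc d`. Unnormalised fractions keep these denominators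
-- visible, and moving the subtracted term to the right gives an inequality in `ℕ`.
clear-denominators : ∀ a r m f d W X E ε → toℚᵘ ε ≡ mkℚᵘ (pos m) f →
  ((pos a) ℚ./ suc r ℚ.+ ε) ℚ.* toℚ W ℚ.- (pos 1) ℚ./ suc d ℚ.* toℚ X ℚ.≤ toℚ E →
  suc d * ((a * suc f + m * suc r) * W) ≤ suc r * suc f * suc d * E + suc r * suc f * X
clear-denominators a r m f d W X E ε ε≡ le = ℤ.drop‿+≤+ (begin
  pos (D * ((a * F + m * R) * W))                     ≡⟨ pos-left ⟩
  pos D ℤ.* ((pos a ℤ.* pos F ℤ.+ pos m ℤ.* pos R) ℤ.* pos W)
    ≡⟨ e₁ (pos a) (pos m) (pos R) (pos F) (pos D) (pos W) (pos X) ⟩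
  L′ (pos D ℤ.* pos 1) (pos R ℤ.* pos F ℤ.* pos 1) ℤ.+ pos R ℤ.* pos F ℤ.* pos X
    ≡⟨ cong₂ (λ x y → L′ x y ℤ.+ pos R ℤ.* pos F ℤ.* pos X) (ℤ.pos-* D 1) pos-RF ⟨
  L′ (pos (D * 1)) (pos (R * F * 1)) ℤ.+ pos R ℤ.* pos F ℤ.* pos X ≤⟨ ℤ.+-monoˡ-≤ (pos R ℤ.* pos F ℤ.* pos X) le″ ⟩
  pos E ℤ.* pos ((R * F * 1) * (D * 1)) ℤ.+ pos R ℤ.* pos F ℤ.* pos X
    ≡⟨ cong (λ x → pos E ℤ.* x ℤ.+ pos R ℤ.* pos F ℤ.* pos X)
         (trans (ℤ.pos-* (R * F * 1) (D * 1)) (cong₂ ℤ._*_ pos-RF (ℤ.pos-* D 1))) ⟩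
  pos E ℤ.* (pos R ℤ.* pos F ℤ.* pos 1 ℤ.* (pos D ℤ.* pos 1)) ℤ.+ pos R ℤ.* pos F ℤ.* pos X
    ≡⟨ e₂ (pos R) (pos F) (pos D) (pos E) (pos X) ⟩
  pos R ℤ.* pos F ℤ.* pos D ℤ.* pos E ℤ.+ pos R ℤ.* pos F ℤ.* pos X         ≡⟨ pos-right ⟨
  pos (R * F * D * E + R * F * X)                   ∎)
  where
  open ℤ.≤-Reasoning
  R F D : ℕ
  R = suc r
  F = suc f
  D = suc d
  L′ : ℤ → ℤ → ℤ
  L′ x y = ((pos a ℤ.* pos F ℤ.+ pos m ℤ.* pos R) ℤ.* pos W ℤ.* x ℤ.+ (ℤ.- (pos 1 ℤ.* pos X)) ℤ.* y) ℤ.* pos 1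
  le″ : L′ (pos (D * 1)) (pos (R * F * 1)) ℤ.≤ pos E ℤ.* pos ((R * F * 1) * (D * 1))
  le″ = ℚᵘ.drop-*≤* (ℚᵘ.≤-respˡ-≃ (unnormalise a r m f d W X ε ε≡) (ℚᵘ.≤-respʳ-≃ (toℚᵘ-/ (pos E) 0) (ℚ.toℚᵘ-mono-≤ le)))
  pos-RF : pos (R * F * 1) ≡ pos R ℤ.* pos F ℤ.* pos 1
  pos-RF = trans (ℤ.pos-* (R * F) 1) (cong (ℤ._* pos 1) (ℤ.pos-* R F))
  pos-left : pos (D * ((a * F + m * R) * W)) ≡ pos D ℤ.* ((pos a ℤ.* pos F ℤ.+ pos m ℤ.* pos R) ℤ.* pos W)
  pos-left = trans (ℤ.pos-* D _) (cong (pos D ℤ.*_) (trans (ℤ.pos-* (a * F + m * R) W) (cong (ℤ._* pos W)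
    (trans (ℤ.pos-+ (a * F) _) (cong₂ ℤ._+_ (ℤ.pos-* a F) (ℤ.pos-* m R))))))
  pos-right : pos (R * F * D * E + R * F * X) ≡ pos R ℤ.* pos F ℤ.* pos D ℤ.* pos E ℤ.+ pos R ℤ.* pos F ℤ.* pos X
  pos-right = trans (ℤ.pos-+ (R * F * D * E) _) (cong₂ ℤ._+_
    (trans (ℤ.pos-* (R * F * D) E) (cong (ℤ._* pos E) (trans (ℤ.pos-* (R * F) D) (cong (ℤ._* pos D) (ℤ.pos-* R F)))))
    (trans (ℤ.pos-* (R * F) X) (cong (ℤ._* pos X) (ℤ.pos-* R F))))
  e₁ : ∀ a m R F D W X → D ℤ.* ((a ℤ.* F ℤ.+ m ℤ.* R) ℤ.* W) ≡
       ((a ℤ.* F ℤ.+ m ℤ.* R) ℤ.* W ℤ.* (D ℤ.* pos 1) ℤ.+ (ℤ.- (pos 1 ℤ.* X)) ℤ.* (R ℤ.* F ℤ.* pos 1)) ℤ.* pos 1 ℤ.+ R ℤ.* F ℤ.* X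
  e₁ = ℤ.solve-∀
  e₂ : ∀ R F D E X → E ℤ.* (R ℤ.* F ℤ.* pos 1 ℤ.* (D ℤ.* pos 1)) ℤ.+ R ℤ.* F ℤ.* X ≡ R ℤ.* F ℤ.* D ℤ.* E ℤ.+ R ℤ.* F ℤ.* X
  e₂ = ℤ.solve-∀

card-cong : ∀ {n} {A B : Fin n → Bool} → (∀ x → A x ≡ B x) → card A ≡ card B
card-cong {n} A≡B = ∑-cong (allFin n) λ x → cong 𝟙 (A≡B x)

missing-cong : ∀ {n} (H : Hypergraph3 n) x {A B : Fin n → Bool} → (∀ x → A x ≡ B x) → missing H x A ≡ missing H x B
missing-cong {n} H x A≡B = ∑-cong (allFin n) λ y → ∑-cong (allFin n) λ z →
  cong₂ (λ a b → 𝟙 a * 𝟙 b * 𝟙 (not (edge H x y z))) (A≡B y) (A≡B z)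

-- Goodness must be decided, with a sparse set as evidence against it, because bad vertices enter a
-- Boolean pair set.
record Verdict (R σ : ℕ) {n : ℕ} (H : Hypergraph3 n) (K : ℕ) (x : Fin n) : Set where
  field
    bad      : Bool
    evidence : Fin n → Bool
    is-large : bad ≡ true → n ≤ K * card evidence
    is-bad   : bad ≡ true → σ * (card evidence * card evidence) ≤ R * (2 + σ) * missing H x evidence
    is-good  : bad ≡ false → Good R σ H K x

-- Goodness ranges over finitely many sets `A`, which are searched as vectors. A set and its vector
-- agree only pointwise, hence the congruence lemmas.
verdict : ∀ R σ {n} (H : Hypergraph3 n) K x → Verdict R σ H K x
verdict R σ {n} H K x with anySubset? {P = λ v → n ≤ K * card (lookup v) ×
                             σ * (card (lookup v) * card (lookup v)) < R * (2 + σ) * missing H x (lookup v)}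
                             (λ v → (n ≤? K * card (lookup v)) ×-dec
                                    (σ * (card (lookup v) * card (lookup v)) <? R * (2 + σ) * missing H x (lookup v)))
... | yes (v , large , many-missing) = record
  { bad = true ; evidence = lookup v ; is-large = λ _ → large ; is-bad = λ _ → <⇒≤ many-missing ; is-good = λ () }
... | no none = record
  { bad = false ; evidence = λ _ → false ; is-large = λ () ; is-bad = λ ()
  ; is-good = λ _ → good-by λ A large → ≮⇒≥ λ lt → none (tabulate A ,
      ≤-trans large (≤-reflexive (cong (K *_) (sym (card-cong (lookup∘tabulate A))))) ,
      subst₂ (λ a m → σ * (a * a) < R * (2 + σ) * m)
        (sym (card-cong (lookup∘tabulate A))) (sym (missing-cong H x (lookup∘tabulate A))) lt) }

module _ {n : ℕ} (R σ K : ℕ) (H : Hypergraph3 n) where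

  bad good : Fin n → Bool
  bad x = Verdict.bad (verdict R σ H K x)
  good x = not (bad x)

  evidence : Fin n → Fin n → Bool
  evidence x = Verdict.evidence (verdict R σ H K x)

  -- The one pair set to which ee-density is applied, as both `P` and `Q`. Then `Kcount` is the
  -- total `weight`, and `ecount` falls short of it by the total `loss`.
  bad-pairs : PairSet n
  bad-pairs x y = bad x ∧ evidence x y

  weight loss : Fin n → ℕ
  weight x = 𝟙 (bad x) * (card (evidence x) * card (evidence x))
  loss x = 𝟙 (bad x) * missing H x (evidence x)

  Kcount-bad : Kcount bad-pairs bad-pairs ≡ ΣFin n weight
  Kcount-bad = ∑-cong (allFin n) at
    where
    at : ∀ x → ∑² (λ y z → 𝟙 (bad-pairs x y) * 𝟙 (bad-pairs x z)) ≡ weight x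
    at x with bad x
    ... | true  = trans (∑²-square (evidence x)) (sym (+-identityʳ _))
    ... | false = trans (∑-cong (allFin n) λ y → trans (ΣFin-const n 0) (*-zeroʳ n)) (trans (ΣFin-const n 0) (*-zeroʳ n))

  ecount-bad : ecount H bad-pairs bad-pairs + ΣFin n loss ≡ ΣFin n weight
  ecount-bad = trans (sym (∑-+ _ loss (allFin n))) (∑-cong (allFin n) at)
    where
    complement : ∀ c b → c * 𝟙 b + c * 𝟙 (not b) ≡ c
    complement c true  = trans (cong₂ _+_ (*-identityʳ c) (*-zeroʳ c)) (+-identityʳ c)
    complement c false = trans (cong₂ _+_ (*-zeroʳ c) (*-identityʳ c)) refl
    decompose : ∀ x A → ∑² (λ y z → square A y z * 𝟙 (edge H x y z)) + missing H x A ≡ card A * card A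
    decompose x A = trans (sym (∑²-+ (λ y z → square A y z * 𝟙 (edge H x y z)) (λ y z → square A y z * 𝟙 (not (edge H x y z)))))
      (trans (∑-cong (allFin n) λ y → ∑-cong (allFin n) λ z → complement (square A y z) (edge H x y z)) (∑²-square A))
    at : ∀ x → ∑² (λ y z → 𝟙 (bad-pairs x y) * 𝟙 (bad-pairs x z) * 𝟙 (edge H x y z)) + loss x ≡ weight x
    at x with bad x
    ... | true  = trans (cong (E +_) (+-identityʳ (missing H x (evidence x))))
                    (trans (decompose x (evidence x)) (sym (+-identityʳ (card (evidence x) * card (evidence x)))))
      where E = ∑² (λ y z → square (evidence x) y z * 𝟙 (edge H x y z))
    ... | false = trans (+-identityʳ _) (trans (∑-cong (allFin n) λ y → trans (ΣFin-const n 0) (*-zeroʳ n))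
                                               (trans (ΣFin-const n 0) (*-zeroʳ n)))

  weight-loss : σ * ΣFin n weight ≤ R * (2 + σ) * ΣFin n loss
  weight-loss = begin
    σ * ΣFin n weight                          ≡⟨ ∑-* σ weight (allFin n) ⟨
    ΣFin n (λ x → σ * weight x)                ≤⟨ ∑-mono-≤ (allFin n) at ⟩
    ΣFin n (λ x → R * (2 + σ) * loss x)        ≡⟨ ∑-* (R * (2 + σ)) loss (allFin n) ⟩
    R * (2 + σ) * ΣFin n loss                  ∎
    where
    open ≤-Reasoning
    at : ∀ x → σ * weight x ≤ R * (2 + σ) * loss x
    at x with bad x in eq
    ... | true  = subst₂ (λ a b → σ * a ≤ R * (2 + σ) * b) (sym (+-identityʳ _)) (sym (+-identityʳ _))
                    (Verdict.is-bad (verdict R σ H K x) eq)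
    ... | false = ≤-trans (≤-reflexive (*-zeroʳ σ)) z≤n

  bad-weight : card bad * (n * n) ≤ K * K * ΣFin n weight
  bad-weight = begin
    card bad * (n * n)                         ≡⟨ *-comm (card bad) (n * n) ⟩
    n * n * card bad                           ≡⟨ ∑-* (n * n) _ (allFin n) ⟨
    ΣFin n (λ x → n * n * 𝟙 (bad x))           ≤⟨ ∑-mono-≤ (allFin n) at ⟩
    ΣFin n (λ x → K * K * weight x)            ≡⟨ ∑-* (K * K) weight (allFin n) ⟩
    K * K * ΣFin n weight                      ∎
    where
    open ≤-Reasoning
    e : ∀ K a → K * a * (K * a) ≡ K * K * (1 * (a * a))
    e = solve-∀
    at : ∀ x → n * n * 𝟙 (bad x) ≤ K * K * weight x
    at x with bad x in eq
    ... | true  = ≤-trans (≤-reflexive (*-identityʳ (n * n)))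
                    (≤-trans (*-mono-≤ large large) (≤-reflexive (e K (card (evidence x)))))
      where
      large : n ≤ K * card (evidence x)
      large = Verdict.is-large (verdict R σ H K x) eq
    ... | false = ≤-trans (≤-reflexive (*-zeroʳ (n * n))) z≤n

  bad+good : card bad + card good ≡ n
  bad+good = trans (sym (∑-+ _ _ (allFin n)))
    (trans (∑-cong (allFin n) λ x → one (bad x)) (trans (ΣFin-const n 1) (*-identityʳ n)))
    where
    one : ∀ b → 𝟙 b + 𝟙 (not b) ≡ 1
    one true  = refl
    one false = refl

-- Here ε ≥ 1 / F and 2 + σ = 4 F, so that Good allows missing density (1 - 2 / (4 F)) / R, more than 1 - d.
bad-weight-bound : ∀ r f m D′ w q e X → let R = suc r ; F = suc f ; D = suc D′ ; σ = 4 * f + 2 in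
  D * ((r * F + suc m * R) * w) ≤ R * F * D * e + R * F * X → e + q ≡ w → σ * w ≤ R * (2 + σ) * q →
  D * w ≤ 2 * F * X
bad-weight-bound r f m D′ w q e X dense split σw≤ =
  *-cancelˡ-≤ (2 * F * R) {{m*n≢0 (2 * F) R}} (+-cancelʳ-≤ (2 * F * D * w + 2 * F * R * (D * w)) _ _ (begin
    2 * F * R * (D * w) + (2 * F * D * w + 2 * F * R * (D * w))                   ≡⟨ a₁ F R D w ⟩
    4 * F * (D * R * w) + 2 * F * D * w                                           ≤⟨ +-cancelʳ-≤ (F * D * (σ * w)) _ _ scaled ⟩
    4 * F * (R * F * X) + 4 * F * D * w                                           ≤⟨ +-monoʳ-≤ (4 * F * (R * F * X)) small ⟩
    4 * F * (R * F * X) + (2 * F * D * w + 2 * F * R * (D * w))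
      ≡⟨ cong (_+ (2 * F * D * w + 2 * F * R * (D * w))) (a₄ F R X) ⟩
    2 * F * R * (2 * F * X) + (2 * F * D * w + 2 * F * R * (D * w))               ∎))
  where
  open ≤-Reasoning
  R F D σ : ℕ
  R = suc r
  F = suc f
  D = suc D′
  σ = 4 * f + 2
  small : 4 * F * D * w ≤ 2 * F * D * w + 2 * F * R * (D * w)
  small = ≤-trans (≤-reflexive (a F D w)) (+-monoʳ-≤ (2 * F * D * w) (*-monoˡ-≤ (D * w) (m≤m*n (2 * F) R)))
    where
    a : ∀ F D w → 4 * F * D * w ≡ 2 * F * D * w + 2 * F * (D * w)
    a = solve-∀
  a₁ : ∀ F R D w → 2 * F * R * (D * w) + (2 * F * D * w + 2 * F * R * (D * w)) ≡ 4 * F * (D * R * w) + 2 * F * D * w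
  a₁ = solve-∀
  a₄ : ∀ F R X → 4 * F * (R * F * X) ≡ 2 * F * R * (2 * F * X)
  a₄ = solve-∀
  -- Divided by `R * F * D`, this reads `w / F + q ≤ w / R + X / D`; the numerator `suc m` of `ε`
  -- has been lowered to 1.
  dense′ : D * R * w + R * F * D * q ≤ F * D * w + R * F * X
  dense′ = +-cancelˡ-≤ (r * F * D * w) _ _ (begin
    r * F * D * w + (D * R * w + R * F * D * q)             ≡⟨ b₁ r F D w q ⟩
    D * ((r * F + 1 * R) * w) + R * F * D * q
      ≤⟨ +-monoˡ-≤ _ (*-monoʳ-≤ D (*-monoˡ-≤ w (+-monoʳ-≤ (r * F) (*-monoˡ-≤ R (s≤s (z≤n {m})))))) ⟩
    D * ((r * F + suc m * R) * w) + R * F * D * q           ≤⟨ +-monoˡ-≤ _ dense ⟩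
    R * F * D * e + R * F * X + R * F * D * q               ≡⟨ b₂ r F D e q X ⟩
    R * F * D * (e + q) + R * F * X                         ≡⟨ cong (λ w → R * F * D * w + R * F * X) split ⟩
    R * F * D * w + R * F * X                               ≡⟨ b₃ r F D w X ⟩
    r * F * D * w + (F * D * w + R * F * X)                 ∎)
    where
    b₁ : ∀ r F D w q → r * F * D * w + (D * suc r * w + suc r * F * D * q) ≡ D * ((r * F + 1 * suc r) * w) + suc r * F * D * q
    b₁ = solve-∀
    b₂ : ∀ r F D e q X → suc r * F * D * e + suc r * F * X + suc r * F * D * q ≡ suc r * F * D * (e + q) + suc r * F * X
    b₂ = solve-∀
    b₃ : ∀ r F D w X → suc r * F * D * w + suc r * F * X ≡ r * F * D * w + (F * D * w + suc r * F * X)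
    b₃ = solve-∀
  -- By `σw≤`, `q` is at least `w / R - w / (2 * F * R)`. What remains is
  -- `w / F ≤ X / D + w / (2 * F * R)`, and `R ≥ 1` gives the claim.
  scaled : 4 * F * (D * R * w) + 2 * F * D * w + F * D * (σ * w) ≤ 4 * F * (R * F * X) + 4 * F * D * w + F * D * (σ * w)
  scaled = begin
    4 * F * (D * R * w) + 2 * F * D * w + F * D * (σ * w)
      ≤⟨ +-monoʳ-≤ (4 * F * (D * R * w) + 2 * F * D * w) (*-monoʳ-≤ (F * D) σw≤) ⟩
    4 * F * (D * R * w) + 2 * F * D * w + F * D * (R * (2 + σ) * q)          ≡⟨ c₁ f R D w q ⟩
    4 * F * (D * R * w + R * F * D * q) + 2 * F * D * w                      ≤⟨ +-monoˡ-≤ _ (*-monoʳ-≤ (4 * F) dense′) ⟩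
    4 * F * (F * D * w + R * F * X) + 2 * F * D * w                          ≡⟨ c₂ f R D w X ⟩
    4 * F * (R * F * X) + 4 * F * D * w + F * D * (σ * w)                    ∎
    where
    c₁ : ∀ f R D w q → 4 * suc f * (D * R * w) + 2 * suc f * D * w + suc f * D * (R * (2 + (4 * f + 2)) * q) ≡
                       4 * suc f * (D * R * w + R * suc f * D * q) + 2 * suc f * D * w
    c₁ = solve-∀
    c₂ : ∀ f R D w X → 4 * suc f * (suc f * D * w + R * suc f * X) + 2 * suc f * D * w ≡
                       4 * suc f * (R * suc f * X) + 4 * suc f * D * w + suc f * D * ((4 * f + 2) * w)
    c₂ = solve-∀

-- Every bad vertex adds at least `(n / K) ^ 2` to the weight, which is at most `2 * F * n ^ 3 / D`.
-- The denominator `D` of `η` exceeds `4 * F * (K * K)`, so at most half of the vertices are bad.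
many-good : ∀ r f m K (ε : ℚ) → toℚᵘ ε ≡ mkℚᵘ (pos (suc m)) f → ∀ {n} → 1 ≤ n → (H : Hypergraph3 n) →
  EEDense H ((pos r) ℚ./ suc r ℚ.+ ε) ((pos 1) ℚ./ suc (4 * suc f * (K * K))) →
  n ≤ 2 * card (good (suc r) (4 * f + 2) K H)
many-good r f m K ε ε≡ {n} 1≤n H dense = +-cancelˡ-≤ n _ _ (begin
  n + n                          ≡⟨ cong₂ _+_ (sym (bad+good R σ K H)) (sym (bad+good R σ K H)) ⟩
  t + g + (t + g)                ≡⟨ a t g ⟩
  2 * t + 2 * g                  ≤⟨ +-monoˡ-≤ (2 * g) 2t≤n ⟩
  n + 2 * g                      ∎)
  where
  open ≤-Reasoning
  R F σ D t g w e : ℕ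
  R = suc r
  F = suc f
  σ = 4 * f + 2
  D = suc (4 * F * (K * K))
  t = card (bad R σ K H)
  g = card (good R σ K H)
  w = ΣFin n (weight R σ K H)
  e = ecount H (bad-pairs R σ K H) (bad-pairs R σ K H)
  a : ∀ t g → t + g + (t + g) ≡ 2 * t + 2 * g
  a = solve-∀
  Dw≤ : D * w ≤ 2 * F * n ^ 3
  Dw≤ = bad-weight-bound r f m (4 * F * (K * K)) w (ΣFin n (loss R σ K H)) e (n ^ 3)
    (clear-denominators r r (suc m) f (4 * F * (K * K)) w (n ^ 3) e ε ε≡
      (subst (λ k → ((pos r) ℚ./ suc r ℚ.+ ε) ℚ.* toℚ k ℚ.- (pos 1) ℚ./ D ℚ.* toℚ (n ^ 3) ℚ.≤ toℚ e)
        (Kcount-bad R σ K H) (dense (bad-pairs R σ K H) (bad-pairs R σ K H))))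
    (ecount-bad R σ K H) (weight-loss R σ K H)
  2t≤n : 2 * t ≤ n
  2t≤n = *-cancelˡ-≤ (2 * F * (n * n)) {{m*n≢0 (2 * F) (n * n) {{_}} {{m*n≢0 n n {{>-nonZero 1≤n}} {{>-nonZero 1≤n}}}}}} (begin
    2 * F * (n * n) * (2 * t)             ≡⟨ b₁ F n t ⟩
    4 * F * (t * (n * n))                 ≤⟨ *-monoʳ-≤ (4 * F) (bad-weight R σ K H) ⟩
    4 * F * (K * K * w)                   ≡⟨ *-assoc (4 * F) (K * K) w ⟨
    4 * F * (K * K) * w                   ≤⟨ *-monoˡ-≤ w (n≤1+n (4 * F * (K * K))) ⟩
    D * w                                 ≤⟨ Dw≤ ⟩
    2 * F * n ^ 3                         ≡⟨ b₂ F n ⟩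
    2 * F * (n * n) * n                   ∎)
    where
    b₁ : ∀ F n t → 2 * F * (n * n) * (2 * t) ≡ 4 * F * (t * (n * n))
    b₁ = solve-∀
    b₂ : ∀ F n → 2 * F * (n * (n * (n * 1))) ≡ 2 * F * (n * n) * n
    b₂ = solve-∀

-- Embedded copies and the choice of constants

clique-lookup : ∀ {n} (H : Hypergraph3 n) {xs} → Clique H xs → ∀ i j k → i ≢ j → j ≢ k → i ≢ k →
                Edge H (List.lookup xs i) (List.lookup xs j) (List.lookup xs k)
clique-lookup H {x ∷ xs} (p , c) zero    zero    k       i≢j j≢k i≢k = contradiction refl i≢j
clique-lookup H {x ∷ xs} (p , c) zero    (suc j) zero    i≢j j≢k i≢k = contradiction refl i≢k
clique-lookup H {x ∷ xs} (p , c) zero    (suc j) (suc k) i≢j j≢k i≢k =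
  AllPairs-lookup (edge-swap₂₃ H) p j k (j≢k ∘ cong suc)
clique-lookup H {x ∷ xs} (p , c) (suc i) zero    zero    i≢j j≢k i≢k = contradiction refl j≢k
clique-lookup H {x ∷ xs} (p , c) (suc i) zero    (suc k) i≢j j≢k i≢k =
  edge-swap₁₂ H (AllPairs-lookup (edge-swap₂₃ H) p i k (i≢k ∘ cong suc))
clique-lookup H {x ∷ xs} (p , c) (suc i) (suc j) zero    i≢j j≢k i≢k =
  edge-swap₂₃ H (edge-swap₁₂ H (AllPairs-lookup (edge-swap₂₃ H) p i j (i≢j ∘ cong suc)))
clique-lookup H {x ∷ xs} (p , c) (suc i) (suc j) (suc k) i≢j j≢k i≢k =
  clique-lookup H c i j k (i≢j ∘ cong suc) (j≢k ∘ cong suc) (i≢k ∘ cong suc)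

third : ∀ {m} → 3 ≤ m → (i j : Fin m) → Σ (Fin m) λ k → j ≢ k × i ≢ k
third (s≤s (s≤s (s≤s _))) zero          zero          = suc zero , (λ ()) , λ ()
third (s≤s (s≤s (s≤s _))) zero          (suc zero)    = suc (suc zero) , (λ ()) , λ ()
third (s≤s (s≤s (s≤s _))) zero          (suc (suc j)) = suc zero , (λ ()) , λ ()
third (s≤s (s≤s (s≤s _))) (suc zero)    zero          = suc (suc zero) , (λ ()) , λ ()
third (s≤s (s≤s (s≤s _))) (suc (suc i)) zero          = suc zero , (λ ()) , λ ()
third (s≤s (s≤s (s≤s _))) (suc i)       (suc j)       = zero , (λ ()) , λ ()

-- Entries at different positions differ because, with a `third` position, they form an edge; this
-- needs three entries.
clique-contains : ∀ {n} (H : Hypergraph3 n) xs → 3 ≤ length xs → Clique H xs → ContainsK H (length xs)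
clique-contains H xs 3≤ c = List.lookup xs , injective , clique-lookup H c
  where
  injective : Injective _≡_ _≡_ (List.lookup xs)
  injective {i} {j} e with i Fin.≟ j
  ... | yes i≡j = i≡j
  ... | no i≢j =
    let (k , j≢k , i≢k) = third 3≤ i j
    in contradiction e (proj₁ (distinct H _ _ _ (clique-lookup H c i j k i≢j j≢k i≢k)))

from-copies : ∀ r m f ε → toℚᵘ ε ≡ mkℚᵘ (pos (suc m)) f →
  (Σ ℕ λ p → Finds (suc r) (4 * f + 2) 0 (suc p) (λ H → Has H (2 + r))) →
  Σ ℚ λ η → Positive η × Σ ℕ λ n₀ → ∀ n → n₀ ≤ n → (H : Hypergraph3 n) →
  EEDense H (threshold (2 + r) ℚ.+ ε) η → ContainsK H (2 ^ (2 + r))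
-- No blocks, hence size 0; the 2 stands for the half of the vertices that is good.
from-copies r m f ε ε≡ (p , B , find) = conclude (find 0 2)
  where
  σ : ℕ
  σ = 4 * f + 2
  extract : ∀ {n K} → 1 ≤ n → (H : Hypergraph3 n) {N : Fin n → Bool} →
            (Σ (Blocks (Fin n)) λ T → T ⊑[ B ] [] ×
              Holds (tuples (suc p)) K (λ Z → All (λ x → N x ≡ true) Z × Has H (2 + r) T Z)) →
            ContainsK H (2 ^ (2 + r))
  extract 1≤n H {N} (T , _ , h) with witness (tuples (suc p)) {P = λ Z → All (λ x → N x ≡ true) Z × Has H (2 + r) T Z} 1≤n h
  ... | _ , _ , has Q l _ c _ = subst (ContainsK H) l (clique-contains H Q 3≤ c)
    where
    3≤ : 3 ≤ length Q
    3≤ = ≤-trans (n≤1+n 3) (≤-trans (*-monoʳ-≤ 4 (m^n>0 2 r)) (≤-reflexive (trans (*-assoc 2 2 (2 ^ r)) (sym l))))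
  conclude : (Σ ℕ λ K → FindsAt (suc r) σ 0 (suc p) (λ H → Has H (2 + r)) B 0 2 K) →
    Σ ℚ λ η → Positive η × Σ ℕ λ n₀ → ∀ n → n₀ ≤ n → (H : Hypergraph3 n) →
    EEDense H (threshold (2 + r) ℚ.+ ε) η → ContainsK H (2 ^ (2 + r))
  conclude (K , finds) =
    -- `η` is fitted to the scale `K` at which vertices must be good. `n₀ = 1` suffices, since a
    -- linear part of a nonempty vertex set is nonempty.
    (pos 1) ℚ./ suc (4 * suc f * (K * K)) , ℚ.normalize-pos 1 (suc (4 * suc f * (K * K))) , 1 ,
    λ n 1≤n H dense → extract 1≤n H
      (finds 1≤n H (good (suc r) σ K H) (many-good r f m K ε ε≡ 1≤n H dense)
        (λ x e → Verdict.is-good (verdict (suc r) σ H K x) (Bool.not-injective e)) [] refl z≤n [])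

theorem1p2 : (r : ℕ) → 2 ≤ r → (ε : ℚ) → Positive ε →
    Σ ℚ (λ η → Positive η × Σ ℕ (λ n₀ → (n : ℕ) → n₀ ≤ n →
    (H : Hypergraph3 n) → EEDense H (threshold r ℚ.+ ε) η →
    ContainsK H (2 ^ r)))
theorem1p2 (suc (suc r)) (s≤s (s≤s _)) ε@(mkℚ (pos (suc m)) f _) _ =
  -- Here `R` is `suc r`, one less than the exponent `2 + r`, and `σ` is the value from
  -- `bad-weight-bound`.
  from-copies r m f ε refl (copies (4 * f + 2) (s≤s z≤n) (2 + r) 0 ≤-refl)
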